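{- Let $G$ be a simple $3$-connected graph with $n$ vertices and $m$ edges. Let $c(G)$ denote the length of a longest cycle of $G$ and $c^*(G)$ the size of a largest bond of $G$. If either (i) $c(G)\ge n-3$, or (ii) $c^*(G)\ge m-n-1$, then every longest cycle of $G$ meets every largest bond of $G$, i.e., for every cycle $C$ of length $c(G)$ and every bond $B$ with $|B|=c^*(G)$, we have $E(C)\cap B\neq\emptyset$.
   Context: A bond of a graph is a minimal nonempty edge-cut; equivalently, for a connected graph $G$, a bond is the set $[X,Y]$ of edges between the parts of a partition $V(G)=X\cup Y$ into nonempty sets such that the induced subgraphs $G[X]$ and $G[Y]$ are both connected. A graph is $k$-connected if it has at least $k+1$ vertices and remains connected whenever fewer than $k$ vertices are removed. A cycle $C$ meets a bond $B$ if they have at least one common edge. -}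

module Defs where

open import Data.Nat using (ℕ; _≤_; _<_; _+_)
open import Data.Fin using (Fin; toℕ)
open import Data.Bool using (Bool; true; false; _∧_; not; _xor_)
open import Data.Nat using (_<ᵇ_)
open import Data.List using (List; []; _∷_; _++_; [_]; length; zip; filterᵇ; allFin; concatMap; map)
open import Data.List.Relation.Unary.All using (All)
open import Data.List.Relation.Unary.Any using (Any)
open import Data.List.Relation.Unary.Unique.Propositional using (Unique)
open import Data.Product using (_×_; _,_; Σ; ∃; ∃-syntax)
open import Relation.Binary.PropositionalEquality using (_≡_; _≢_)
open import Relation.Nullary using (¬_)

record Graph (n : ℕ) : Set where
  field
    adj   : Fin n → Fin n → Bool
    sym   : ∀ u v → adj u v ≡ adj v u
    loopless : ∀ v → adj v v ≡ false
open Graph public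

VSet : ℕ → Set
VSet n = Fin n → Bool

pairs : (n : ℕ) → List (Fin n × Fin n)
pairs n = concatMap (λ i → map (λ j → (i , j)) (filterᵇ (λ j → toℕ i <ᵇ toℕ j) (allFin n))) (allFin n)

numEdges : ∀ {n} → Graph n → ℕ
numEdges {n} G = length (filterᵇ (λ p → adj G (Data.Product.proj₁ p) (Data.Product.proj₂ p)) (pairs n))
  where import Data.Product

data PathIn {n} (G : Graph n) (U : VSet n) : Fin n → Fin n → Set where
  here : ∀ {u} → U u ≡ true → PathIn G U u u
  step : ∀ {u w v} → U u ≡ true → adj G u w ≡ true → PathIn G U w v → PathIn G U u v

ConnectedOn : ∀ {n} → Graph n → VSet n → Set
ConnectedOn G U = ∀ u v → U u ≡ true → U v ≡ true → PathIn G U u v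

size : ∀ {n} → VSet n → ℕ
size {n} U = length (filterᵇ U (allFin n))

KConnected : ∀ {n} → ℕ → Graph n → Set
KConnected {n} k G = (k + 1 ≤ n) × (∀ (S : VSet n) → size S < k → ConnectedOn G (λ v → not (S v)))

-- A bond is [X, Y] for a partition V = X ∪ Y (Y the complement of X) into nonempty sets with
-- G[X] and G[Y] connected.  We describe a bond by such an X.
IsBondSide : ∀ {n} → Graph n → VSet n → Set
IsBondSide G X =
  (∃[ x ] X x ≡ true) × (∃[ y ] X y ≡ false) ×
  ConnectedOn G X × ConnectedOn G (λ v → not (X v))

bondSize : ∀ {n} → Graph n → VSet n → ℕ
bondSize {n} G X =
  length (filterᵇ (λ p → adj G (Data.Product.proj₁ p) (Data.Product.proj₂ p)
                         ∧ (X (Data.Product.proj₁ p) xor X (Data.Product.proj₂ p))) (pairs n))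
  where import Data.Product

cycleEdges : ∀ {n} → List (Fin n) → List (Fin n × Fin n)
cycleEdges [] = []
cycleEdges (v ∷ vs) = zip (v ∷ vs) (vs ++ [ v ])

IsCycle : ∀ {n} → Graph n → List (Fin n) → Set
IsCycle G vs = (3 ≤ length vs) × Unique vs ×
  All (λ p → adj G (Data.Product.proj₁ p) (Data.Product.proj₂ p) ≡ true) (cycleEdges vs)
  where import Data.Product

-- The length of a cycle is its number of edges = number of vertices.
-- A longest cycle: a cycle of length c(G).
IsLongestCycle : ∀ {n} → Graph n → List (Fin n) → Set
IsLongestCycle G C = IsCycle G C × (∀ C' → IsCycle G C' → length C' ≤ length C)

IsLargestBond : ∀ {n} → Graph n → VSet n → Set
IsLargestBond G X = IsBondSide G X × (∀ X' → IsBondSide G X' → bondSize G X' ≤ bondSize G X)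

Meets : ∀ {n} → List (Fin n) → VSet n → Set
Meets C X = Any (λ p → X (Data.Product.proj₁ p) ≢ X (Data.Product.proj₂ p)) (cycleEdges C)
  where import Data.Product

module Submission where

-- Suppose a longest cycle with vertex set K misses a largest bond. Then K lies on one side of the
-- bond; let Y be the other side.
--
-- Few edges outside the bond: let D be the component of G − K containing Y. By 3-connectedness D has
-- three attachments on the cycle, and their successors s₁, s₂, s₃ are pairwise unlinked outside D,
-- since otherwise the cycle could be rerouted through D and made longer. Each sᵢ has a third edge,
-- and the side ∁ Y stays connected after deleting these three edges together with one cycle edge;
-- hence ∁ Y spans at least |∁ Y| + 3 edges, and Y at least |Y| − 1, too many for (ii).
--
-- Few vertices outside the cycle: if a on the cycle is attached to Y, its successor b is not, so
-- moving b after a to the side of Y enlarges the bond again. By maximality moving a alone shrinks it: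
-- a has more neighbours in Y than outside, and at least two outside, whence |Y| ≥ 3. Then Y is
-- everything off the cycle and a is adjacent to all of Y, so the vertex following b is not attached
-- either, and moving it as well yields a larger bond. The cases |Y| ≤ 2 only need a chosen such that
-- these moves keep the other side connected.

open import Defs hiding (sym)
import Algebra.Solver.CommutativeMonoid as CommutativeMonoidSolver
open import Data.Bool using (Bool; true; false; _∧_; _∨_; not; _xor_)
open import Data.Bool.Properties using (¬-not; not-injective; ∨-comm) renaming (_≟_ to _≟ᵇ_)
open import Data.Empty using (⊥; ⊥-elim)
open import Data.Fin using (Fin; zero; suc; toℕ)
open import Data.Fin.Patterns using (0F; 1F; 2F; 3F; 4F; 5F; 6F; 7F)
open import Data.Fin.Properties using (_≟_; any?; toℕ-injective)
open import Data.List using (List; []; _∷_; _++_; [_]; length; filterᵇ; allFin; concatMap; map; tabulate; reverse; zip)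
open import Data.List.Membership.DecPropositional using (_∈?_)
open import Data.List.Membership.Propositional using (_∈_; _∉_)
open import Data.List.Membership.Propositional.Properties using (∈-∃++; ∈-++⁺ʳ; ∈-++⁻)
open import Data.List.Properties using (length-++; ++-assoc; unfold-reverse)
open import Data.List.Relation.Binary.Permutation.Propositional using (_↭_; ↭-sym; ↭-trans; ↭⇒↭ₛ)
open import Data.List.Relation.Binary.Permutation.Propositional.Properties
  using (↭-length; ↭-reverse; ++-comm; shift; ++-commutativeMonoid; ∈-resp-↭)
  renaming (++⁺ˡ to ↭-++⁺ˡ; ++⁺ʳ to ↭-++⁺ʳ)
open import Data.List.Relation.Binary.Permutation.Setoid.Properties using (Unique-resp-↭)
open import Data.List.Relation.Unary.All as All using (All; []; _∷_)
open import Data.List.Relation.Unary.All.Properties using (¬Any⇒All¬; ++⁺)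
open import Data.List.Relation.Unary.AllPairs using ([]; _∷_)
open import Data.List.Relation.Unary.Any as Any using (here; there)
open import Data.List.Relation.Unary.Unique.Propositional using (Unique)
open import Data.List.Relation.Unary.Unique.Propositional.Properties using () renaming (++⁺ to Unique-++⁺)
open import Data.Nat using (ℕ; zero; suc; _+_; _≤_; _<_; z≤n; s≤s; _<ᵇ_)
open import Data.Nat.Properties hiding (_≟_)
open import Data.Product using (∃; ∃₂; ∃-syntax; _×_; _,_; proj₁; proj₂)
open import Data.Sum using (_⊎_; inj₁; inj₂)
open import Data.Vec using () renaming ([] to []ᵛ; _∷_ to _∷ᵛ_)
open import Function using (_∘_; id; case_of_)
open import Relation.Binary using (tri<; tri≈; tri>)
open import Relation.Binary.PropositionalEquality
  using (_≡_; _≢_; refl; sym; trans; cong; cong₂; subst; setoid; module ≡-Reasoning)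
open import Relation.Nullary using (¬_; Dec; yes; no; does; contradiction)
open import Relation.Nullary.Decidable using (_×-dec_; ¬?; dec-true; dec-false; decidable-stable)
open import Relation.Nullary.Reflects using (ofʸ; ofⁿ)
open import Algebra.Properties.CommutativeMonoid.Sum +-0-commutativeMonoid
  using (sum; sum-cong-≗; ∑-distrib-+)

-- Counting vertices and edges

-- The constants come from two counts. For (ii), what is left of `∁ Y` after four deletions is
-- connected and so still has |∁ Y| - 1 edges; with |Y| - 1 edges inside `Y`, at least n + 2 edges
-- lie outside the bond, one more than (ii) permits. The danger in the deletions is a part of G - K
-- outside `D` that hangs on the cycle by deleted edges only. Since the successors are unlinked,
-- such a part touches at most one of these edges, and 3-connectedness gives it another exit. For
-- (i), |Y| ≤ 3, so moving `a` takes at most three edges out of the bond and brings at least its two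
-- cycle edges in: a net loss of at most 1. Each of the two later moves gains at least 1, which
-- beats the loss. The remaining cycle vertices form a path, so connectedness of the far side is at
-- stake only if vertices off the cycle lie there too. With one such vertex |Y| ≤ 2, and three
-- neighbours of `a` in `Y` are already impossible; with two or more |Y| = 1, and moving one vertex
-- is enough.

ι : Bool → ℕ
ι true  = 1
ι false = 0

count : ∀ {A : Set} → (A → Bool) → List A → ℕ
count p xs = length (filterᵇ p xs)

count-∷ : ∀ {A : Set} (p : A → Bool) x xs → count p (x ∷ xs) ≡ ι (p x) + count p xs
count-∷ p x xs with p x
... | true  = refl
... | false = refl

count-++ : ∀ {A : Set} (p : A → Bool) xs ys → count p (xs ++ ys) ≡ count p xs + count p ys
count-++ p []       ys = refl
count-++ p (x ∷ xs) ys = begin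
  count p (x ∷ xs ++ ys)             ≡⟨ count-∷ p x (xs ++ ys) ⟩
  ι (p x) + count p (xs ++ ys)       ≡⟨ cong (ι (p x) +_) (count-++ p xs ys) ⟩
  ι (p x) + (count p xs + count p ys) ≡⟨ +-assoc (ι (p x)) _ _ ⟨
  ι (p x) + count p xs + count p ys  ≡⟨ cong (_+ count p ys) (count-∷ p x xs) ⟨
  count p (x ∷ xs) + count p ys      ∎
  where open ≡-Reasoning

count-tabulate : ∀ {A : Set} {n} (p : A → Bool) (f : Fin n → A) →
                 count p (tabulate f) ≡ sum (λ i → ι (p (f i)))
count-tabulate {n = zero}  p f = refl
count-tabulate {n = suc n} p f =
  trans (count-∷ p (f zero) _) (cong (ι (p (f zero)) +_) (count-tabulate p (f ∘ suc)))

count-map-filter : ∀ {A B : Set} (p : B → Bool) (f : A → B) (q : A → Bool) xs →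
                   count p (map f (filterᵇ q xs)) ≡ count (λ x → q x ∧ p (f x)) xs
count-map-filter p f q [] = refl
count-map-filter p f q (x ∷ xs) with q x
... | false = count-map-filter p f q xs
... | true  with p (f x)
...   | true  = cong suc (count-map-filter p f q xs)
...   | false = count-map-filter p f q xs

count-concatMap : ∀ {A B : Set} {n} (p : B → Bool) (g : A → List B) (h : Fin n → A) →
                  count p (concatMap g (tabulate h)) ≡ sum (λ i → count p (g (h i)))
count-concatMap {n = zero}  p g h = refl
count-concatMap {n = suc n} p g h =
  trans (count-++ p (g (h zero)) _) (cong (count p (g (h zero)) +_) (count-concatMap p g (h ∘ suc)))

sum-zero : ∀ {n} (g : Fin n → ℕ) → (∀ i → g i ≡ 0) → sum g ≡ 0
sum-zero {zero}  g z = refl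
sum-zero {suc n} g z = cong₂ _+_ (z zero) (sum-zero (g ∘ suc) (z ∘ suc))

sum-δ : ∀ {n} (v : Fin n) (g : Fin n → ℕ) → (∀ i → i ≢ v → g i ≡ 0) → sum g ≡ g v
sum-δ zero g z =
  trans (cong (g zero +_) (sum-zero (g ∘ suc) (λ i → z (suc i) λ ()))) (+-identityʳ _)
sum-δ (suc v) g z =
  cong₂ _+_ (z zero λ ()) (sum-δ v (g ∘ suc) λ i i≢v → z (suc i) λ { refl → i≢v refl })

infix 7 _≡ᵇ_
_≡ᵇ_ : ∀ {n} → Fin n → Fin n → Bool
x ≡ᵇ y = does (x ≟ y)

≡ᵇ-refl : ∀ {n} (x : Fin n) → x ≡ᵇ x ≡ true
≡ᵇ-refl x = dec-true (x ≟ x) refl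

≢⇒≡ᵇ : ∀ {n} {x y : Fin n} → x ≢ y → x ≡ᵇ y ≡ false
≢⇒≡ᵇ {x = x} {y} = dec-false (x ≟ y)

true≢false : ∀ {b} → b ≡ true → b ≡ false → ⊥
true≢false refl ()

∧-elim : ∀ {a b} → a ∧ b ≡ true → a ≡ true × b ≡ true
∧-elim {true} {true} _ = refl , refl

∧-intro : ∀ {a b} → a ≡ true → b ≡ true → a ∧ b ≡ true
∧-intro refl refl = refl

not-true : ∀ {b} → not b ≡ true → b ≡ false
not-true {false} _ = refl

not-false : ∀ {b} → b ≡ false → not b ≡ true
not-false refl = refl

-- Vertex sets, their sizes and pair counts

module _ {n : ℕ} where

  infixl 6 _∪⁅_⁆ _∖⁅_⁆ _∩_

  ∁ : VSet n → VSet n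
  ∁ U x = not (U x)

  _∩_ : VSet n → VSet n → VSet n
  (U ∩ V) x = U x ∧ V x

  _∪⁅_⁆ : VSet n → Fin n → VSet n
  (U ∪⁅ v ⁆) x = U x ∨ x ≡ᵇ v

  _∖⁅_⁆ : VSet n → Fin n → VSet n
  (U ∖⁅ v ⁆) x = U x ∧ not (x ≡ᵇ v)

  _⊆_ : VSet n → VSet n → Set
  U ⊆ V = ∀ x → U x ≡ true → V x ≡ true

  ∪⁺ˡ : ∀ {U} v {x} → U x ≡ true → (U ∪⁅ v ⁆) x ≡ true
  ∪⁺ˡ v p rewrite p = refl

  ∪⁺ʳ : ∀ U v → (U ∪⁅ v ⁆) v ≡ true
  ∪⁺ʳ U v rewrite ≡ᵇ-refl v with U v
  ... | true  = refl
  ... | false = refl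

  ∪⁻ : ∀ U v {x} → (U ∪⁅ v ⁆) x ≡ true → U x ≡ true ⊎ x ≡ v
  ∪⁻ U v {x} p with U x | x ≟ v
  ... | true  | _     = inj₁ refl
  ... | false | yes q = inj₂ q

  ∪∁⁺ : ∀ U v {x} → U x ≡ false → x ≢ v → (U ∪⁅ v ⁆) x ≡ false
  ∪∁⁺ U v p q rewrite p = ≢⇒≡ᵇ q

  ∪∁⁻ : ∀ U v {x} → (U ∪⁅ v ⁆) x ≡ false → U x ≡ false × x ≢ v
  ∪∁⁻ U v {x} p with U x | x ≟ v
  ... | false | no q = refl , q

  ∖⁺ : ∀ U v {x} → U x ≡ true → x ≢ v → (U ∖⁅ v ⁆) x ≡ true
  ∖⁺ U v p q rewrite p | ≢⇒≡ᵇ q = refl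

  ∖⁻ : ∀ U v {x} → (U ∖⁅ v ⁆) x ≡ true → U x ≡ true × x ≢ v
  ∖⁻ U v {x} p with U x | x ≟ v
  ... | true | no q = refl , q

  size-sum : ∀ (U : VSet n) → size U ≡ sum (λ x → ι (U x))
  size-sum U = count-tabulate U id

  -- Reduces counting to an identity of indicators at each vertex. Two sets on each side avoid
  -- truncated subtraction; the empty set fills a vacant place.
  size-additive : ∀ (U V X Y : VSet n) → (∀ x → ι (U x) + ι (V x) ≡ ι (X x) + ι (Y x)) →
                  size U + size V ≡ size X + size Y
  size-additive U V X Y eq = begin
    size U + size V                 ≡⟨ cong₂ _+_ (size-sum U) (size-sum V) ⟩
    sum (ι ∘ U) + sum (ι ∘ V)       ≡⟨ ∑-distrib-+ (ι ∘ U) (ι ∘ V) ⟨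
    sum (λ x → ι (U x) + ι (V x))   ≡⟨ sum-cong-≗ eq ⟩
    sum (λ x → ι (X x) + ι (Y x))   ≡⟨ ∑-distrib-+ (ι ∘ X) (ι ∘ Y) ⟩
    sum (ι ∘ X) + sum (ι ∘ Y)       ≡⟨ cong₂ _+_ (size-sum X) (size-sum Y) ⟨
    size X + size Y                 ∎
    where open ≡-Reasoning

  size-∅ : ∀ (U : VSet n) → (∀ x → U x ≡ false) → size U ≡ 0
  size-∅ U e = trans (size-sum U) (sum-zero _ (λ x → cong ι (e x)))

  size-⁅⁆ : ∀ v → size (_≡ᵇ v) ≡ 1
  size-⁅⁆ v = trans (size-sum (_≡ᵇ v))
    (trans (sum-δ v (λ x → ι (x ≡ᵇ v)) λ i i≢v → cong ι (≢⇒≡ᵇ i≢v)) (cong ι (≡ᵇ-refl v)))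

  size-mono : ∀ {U V : VSet n} → U ⊆ V → size U ≤ size V
  size-mono {U} {V} sub = subst (size U ≤_) eq (m≤m+n (size U) (size (V ∩ ∁ U)))
    where
    pt : ∀ x → ι (U x) + ι ((V ∩ ∁ U) x) ≡ ι (V x) + 0
    pt x with U x in e
    ... | true  rewrite sub x e = refl
    ... | false with V x
    ...   | true  = refl
    ...   | false = refl
    eq : size U + size (V ∩ ∁ U) ≡ size V
    eq = trans (size-additive U (V ∩ ∁ U) V (λ _ → false) pt)
               (trans (cong (size V +_) (size-∅ (λ _ → false) λ _ → refl)) (+-identityʳ _))

  size-∖ : ∀ (U : VSet n) v → U v ≡ true → size U ≡ suc (size (U ∖⁅ v ⁆))
  size-∖ U v Uv = begin
    size U                            ≡⟨ +-identityʳ _ ⟨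
    size U + 0                        ≡⟨ cong (size U +_) (size-∅ (λ _ → false) λ _ → refl) ⟨
    size U + size {n} (λ _ → false)   ≡⟨ size-additive _ _ _ _ pt ⟩
    size (_≡ᵇ v) + size (U ∖⁅ v ⁆) ≡⟨ cong (_+ size (U ∖⁅ v ⁆)) (size-⁅⁆ v) ⟩
    suc (size (U ∖⁅ v ⁆))             ∎
    where
    open ≡-Reasoning
    pt : ∀ x → ι (U x) + 0 ≡ ι (x ≡ᵇ v) + ι ((U ∖⁅ v ⁆) x)
    pt x with x ≟ v
    ... | yes refl rewrite Uv = refl
    ... | no  _    with U x
    ...   | true  = refl
    ...   | false = refl

  size-∪ : ∀ (U : VSet n) v → U v ≡ false → size (U ∪⁅ v ⁆) ≡ suc (size U)
  size-∪ U v Uv = trans (size-∖ _ v (∪⁺ʳ U v)) (cong suc (≤-antisym (size-mono fwd) (size-mono bwd)))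
    where
    fwd : ((U ∪⁅ v ⁆) ∖⁅ v ⁆) ⊆ U
    fwd x p with ∖⁻ (U ∪⁅ v ⁆) v p
    ... | q , x≢v with ∪⁻ U v q
    ...   | inj₁ r = r
    ...   | inj₂ r = contradiction r x≢v
    bwd : U ⊆ ((U ∪⁅ v ⁆) ∖⁅ v ⁆)
    bwd x p = ∖⁺ (U ∪⁅ v ⁆) v (∪⁺ˡ {U} v p) λ { refl → true≢false p Uv }

  size-∁ : ∀ (U : VSet n) → size U + size (∁ U) ≡ n
  size-∁ U = begin
    size U + size (∁ U)             ≡⟨ size-additive _ _ (λ _ → true) (λ _ → false) pt ⟩
    size {n} (λ _ → true) + size {n} (λ _ → false) ≡⟨ cong₂ _+_ (trans (size-sum _) (ones n)) (size-∅ (λ _ → false) λ _ → refl) ⟩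
    n + 0                           ≡⟨ +-identityʳ n ⟩
    n ∎
    where
    open ≡-Reasoning
    pt : ∀ x → ι (U x) + ι (∁ U x) ≡ 1
    pt x with U x
    ... | true  = refl
    ... | false = refl
    ones : ∀ m → sum {m} (λ _ → 1) ≡ m
    ones zero    = refl
    ones (suc m) = cong suc (ones m)

  length≤size : ∀ {vs} (U : VSet n) → Unique vs → All (λ x → U x ≡ true) vs → length vs ≤ size U
  length≤size U [] [] = z≤n
  length≤size {v ∷ vs} U (v∉vs ∷ uniq) (Uv ∷ Uvs) =
    subst (suc (length vs) ≤_) (sym (size-∖ U v Uv))
      (s≤s (length≤size (U ∖⁅ v ⁆) uniq
        (All.zipWith (λ (p , q) → ∖⁺ U v p (q ∘ sym)) (Uvs , v∉vs))))

  size≤length : ∀ (U : VSet n) vs → (∀ x → U x ≡ true → x ∈ vs) → size U ≤ length vs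
  size≤length U [] sub = ≤-reflexive (size-∅ U λ x → none x)
    where
    none : ∀ x → U x ≡ false
    none x with U x in e
    ... | false = refl
    ... | true with () ← sub x e
  size≤length U (v ∷ vs) sub = ≤-trans bound (s≤s (size≤length (U ∖⁅ v ⁆) vs sub′))
    where
    sub′ : ∀ x → (U ∖⁅ v ⁆) x ≡ true → x ∈ vs
    sub′ x p with ∖⁻ U v p
    ... | Ux , x≢v with sub x Ux
    ...   | here x≡v  = contradiction x≡v x≢v
    ...   | there x∈vs = x∈vs
    bound : size U ≤ suc (size (U ∖⁅ v ⁆))
    bound with U v in e
    ... | true  = ≤-reflexive (size-∖ U v e)
    ... | false = m≤n⇒m≤1+n (size-mono λ x p → ∖⁺ U v p λ { refl → true≢false p e })

  two≤size : ∀ (U : VSet n) {x y} → U x ≡ true → U y ≡ true → x ≢ y → 2 ≤ size U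
  two≤size U p q x≢y = length≤size U ((x≢y ∷ []) ∷ ([] ∷ [])) (p ∷ q ∷ [])

  countPairs : (Fin n → Fin n → Bool) → ℕ
  countPairs f = length (filterᵇ (λ p → f (proj₁ p) (proj₂ p)) (pairs n))

  countPairs-sum : ∀ f → countPairs f ≡ sum (λ i → sum (λ j → ι ((toℕ i <ᵇ toℕ j) ∧ f i j)))
  countPairs-sum f = trans (count-concatMap (λ p → f (proj₁ p) (proj₂ p)) row id) (sum-cong-≗ λ i →
    trans (count-map-filter (λ p → f (proj₁ p) (proj₂ p)) (i ,_) (λ j → toℕ i <ᵇ toℕ j) (allFin n))
          (count-tabulate (λ j → (toℕ i <ᵇ toℕ j) ∧ f i j) id))
    where
    row : Fin n → List (Fin n × Fin n)
    row i = map (i ,_) (filterᵇ (λ j → toℕ i <ᵇ toℕ j) (allFin n))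

  countPairs-additive : ∀ f g h k → (∀ i j → ι (f i j) + ι (g i j) ≡ ι (h i j) + ι (k i j)) →
                        countPairs f + countPairs g ≡ countPairs h + countPairs k
  countPairs-additive f g h k eq = begin
    countPairs f + countPairs g    ≡⟨ cong₂ _+_ (countPairs-sum f) (countPairs-sum g) ⟩
    sum (S f) + sum (S g)          ≡⟨ ∑-distrib-+ (S f) (S g) ⟨
    sum (λ i → S f i + S g i)      ≡⟨ sum-cong-≗ row ⟩
    sum (λ i → S h i + S k i)      ≡⟨ ∑-distrib-+ (S h) (S k) ⟩
    sum (S h) + sum (S k)          ≡⟨ cong₂ _+_ (countPairs-sum h) (countPairs-sum k) ⟨
    countPairs h + countPairs k    ∎
    where
    open ≡-Reasoning
    E : (Fin n → Fin n → Bool) → Fin n → Fin n → ℕ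
    E f i j = ι ((toℕ i <ᵇ toℕ j) ∧ f i j)
    S : (Fin n → Fin n → Bool) → Fin n → ℕ
    S f i = sum (E f i)
    cell : ∀ i j → E f i j + E g i j ≡ E h i j + E k i j
    cell i j with toℕ i <ᵇ toℕ j
    ... | true  = eq i j
    ... | false = refl
    row : ∀ i → S f i + S g i ≡ S h i + S k i
    row i = trans (sym (∑-distrib-+ (E f i) (E g i)))
              (trans (sum-cong-≗ (cell i)) (∑-distrib-+ (E h i) (E k i)))

  countPairs-∅ : countPairs (λ _ _ → false) ≡ 0
  countPairs-∅ = trans (countPairs-sum _) (sum-zero _ λ i → sum-zero _ λ j → zz i j)
    where
    zz : ∀ (i j : Fin n) → ι ((toℕ i <ᵇ toℕ j) ∧ false) ≡ 0
    zz i j with toℕ i <ᵇ toℕ j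
    ... | true  = refl
    ... | false = refl

  -- The pairs joining `v` to a member of `h`. With neighbours of `v` as leaves these are the edges
  -- affected when `v` changes sides; with one leaf it is a single edge.
  star : Fin n → VSet n → Fin n → Fin n → Bool
  star v h i j = (i ≡ᵇ v ∧ h j) ∨ (j ≡ᵇ v ∧ h i)

  -- Pairs are listed with the smaller index first, so a leaf is counted either in row `v` or in
  -- column `v`, never in both. No listed pair repeats a vertex, hence `v` must not be its own leaf.
  countPairs-star : ∀ v h → h v ≡ false → countPairs (star v h) ≡ size h
  countPairs-star v h hv = begin
    countPairs (star v h)                             ≡⟨ countPairs-sum _ ⟩
    sum (λ i → sum (λ j → ι ((i <! j) ∧ star v h i j)))
      ≡⟨ sum-cong-≗ (λ i → trans (sum-cong-≗ (cell i)) (∑-distrib-+ (A i) (B i))) ⟩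
    sum (λ i → sum (A i) + sum (B i))                 ≡⟨ ∑-distrib-+ (sum ∘ A) (sum ∘ B) ⟩
    sum (sum ∘ A) + sum (sum ∘ B)                     ≡⟨ cong₂ _+_ sumA sumB ⟩
    sum (A v) + sum (λ i → B i v)                     ≡⟨ ∑-distrib-+ (A v) (λ i → B i v) ⟨
    sum (λ j → A v j + B j v)                         ≡⟨ sum-cong-≗ merge ⟩
    sum (ι ∘ h)                                       ≡⟨ size-sum h ⟨
    size h                                            ∎
    where
    open ≡-Reasoning
    _<!_ : Fin n → Fin n → Bool
    i <! j = toℕ i <ᵇ toℕ j
    A B : Fin n → Fin n → ℕ
    A i j = ι (i ≡ᵇ v ∧ ((i <! j) ∧ h j))
    B i j = ι (j ≡ᵇ v ∧ ((i <! j) ∧ h i))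
    <!-irrefl : ∀ (i j : Fin n) → ¬ (toℕ i < toℕ j) → (i <! j) ≡ false
    <!-irrefl i j ¬lt with toℕ i <ᵇ toℕ j | <ᵇ-reflects-< (toℕ i) (toℕ j)
    ... | true  | ofʸ lt = contradiction lt ¬lt
    ... | false | _      = refl
    <!-true : ∀ (i j : Fin n) → toℕ i < toℕ j → (i <! j) ≡ true
    <!-true i j lt with toℕ i <ᵇ toℕ j | <ᵇ-reflects-< (toℕ i) (toℕ j)
    ... | true  | _       = refl
    ... | false | ofⁿ ¬lt = contradiction lt ¬lt
    cell : ∀ i j → ι ((i <! j) ∧ star v h i j) ≡ A i j + B i j
    cell i j with i ≟ v | j ≟ v
    ... | yes refl | yes refl rewrite <!-irrefl i i (<-irrefl refl) = refl
    ... | yes refl | no _ with i <! j | h j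
    ...   | true  | true  = refl
    ...   | true  | false = refl
    ...   | false | _     = refl
    cell i j | no _ | yes refl = refl
    cell i j | no _ | no _ with i <! j
    ...   | true  = refl
    ...   | false = refl
    sumA : sum (sum ∘ A) ≡ sum (A v)
    sumA = sum-δ v (sum ∘ A) λ i i≢v → sum-zero (A i) λ j → cong (λ b → ι (b ∧ ((i <! j) ∧ h j))) (≢⇒≡ᵇ i≢v)
    sumB : sum (sum ∘ B) ≡ sum (λ i → B i v)
    sumB = sum-cong-≗ λ i → sum-δ v (B i) λ j j≢v → cong (λ b → ι (b ∧ ((i <! j) ∧ h i))) (≢⇒≡ᵇ j≢v)
    merge : ∀ j → A v j + B j v ≡ ι (h j)
    merge j rewrite ≡ᵇ-refl v with <-cmp (toℕ v) (toℕ j)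
    ... | tri< lt _ ¬gt rewrite <!-true v j lt | <!-irrefl j v ¬gt = +-identityʳ _
    ... | tri> ¬lt _ gt rewrite <!-irrefl v j ¬lt | <!-true j v gt = refl
    ... | tri≈ ¬lt eq ¬gt rewrite toℕ-injective (sym eq) | <!-irrefl v v ¬lt | hv = refl

-- Paths, components and edge counts

module _ {n : ℕ} {G : Graph n} where

  adj-sym : ∀ {u v} → adj G u v ≡ true → adj G v u ≡ true
  adj-sym {u} {v} p = trans (Graph.sym G v u) p

  adj⇒≢ : ∀ {u v} → adj G u v ≡ true → u ≢ v
  adj⇒≢ {u} p refl = true≢false p (loopless G u)

  path-source : ∀ {U u v} → PathIn G U u v → U u ≡ true
  path-source (here p)     = p
  path-source (step p _ _) = p

  path-trans : ∀ {U u v w} → PathIn G U u v → PathIn G U v w → PathIn G U u w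
  path-trans (here _)     q = q
  path-trans (step a e p) q = step a e (path-trans p q)

  path-sym : ∀ {U u v} → PathIn G U u v → PathIn G U v u
  path-sym (here a)     = here a
  path-sym (step a e p) = path-trans (path-sym p) (step (path-source p) (adj-sym e) (here a))

  path-mono : ∀ {U V u v} → U ⊆ V → PathIn G U u v → PathIn G V u v
  path-mono s (here a)     = here (s _ a)
  path-mono s (step a e p) = step (s _ a) e (path-mono s p)

  path-target : ∀ {U u v} → PathIn G U u v → U v ≡ true
  path-target p = path-source (path-sym p)

  connected-cong : ∀ {U V} → U ⊆ V → V ⊆ U → ConnectedOn G U → ConnectedOn G V
  connected-cong s t c u v p q = path-mono s (c u v (t u p) (t v q))

  connected-from : ∀ {U} r → (∀ x → U x ≡ true → PathIn G U r x) → ConnectedOn G U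
  connected-from r f u v p q = path-trans (path-sym (f u p)) (f v q)

  path-exit : ∀ {U u v} (T : VSet n) → T u ≡ true → T v ≡ false → PathIn G U u v →
              ∃₂ λ p q → T p ≡ true × T q ≡ false × U q ≡ true × adj G p q ≡ true
  path-exit T a b (here _) = ⊥-elim (true≢false a b)
  path-exit T a b (step {u} {w} _ e p) with T w in eq
  ... | true  = path-exit T eq b p
  ... | false = u , w , a , eq , path-source p , e

  path-first-hit : ∀ {U u v} (K : VSet n) → K u ≡ false → K v ≡ true → PathIn G U u v →
                   ∃₂ λ w c → PathIn G (U ∩ ∁ K) u w × adj G w c ≡ true × U c ≡ true × K c ≡ true
  path-first-hit K a b (here _) = ⊥-elim (true≢false b a)
  path-first-hit K a b (step {u} {w} x e p) with K w in eq
  ... | true  = u , w , here (∧-intro x (not-false a)) , e , path-source p , eq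
  ... | false with path-first-hit K eq b p
  ...   | w′ , c , q , e′ , Uc , Kc =
    w′ , c , step (∧-intro x (not-false a)) e q , e′ , Uc , Kc

  -- For `T` inside `U`: `T` is a union of components of the subgraph induced on `U`.
  Closed : VSet n → VSet n → Set
  Closed U T = ∀ p q → T p ≡ true → U q ≡ true → adj G p q ≡ true → T q ≡ true

  path-in-closed : ∀ {U T u v} → Closed U T → T u ≡ true → PathIn G U u v → PathIn G T u v
  path-in-closed c a (here _)     = here a
  path-in-closed c a (step _ e p) = step a e (path-in-closed c (c _ _ a (path-source p) e) p)

  path-neighbour : ∀ {U u v} → u ≢ v → PathIn G U u v → ∃ λ w → U w ≡ true × adj G u w ≡ true
  path-neighbour u≢v (here _)     = contradiction refl u≢v
  path-neighbour u≢v (step _ e p) = _ , path-source p , e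

path-transfer : ∀ {n} {G H : Graph n} {U u v} →
                (∀ x y → U x ≡ true → U y ≡ true → adj G x y ≡ true → adj H x y ≡ true) →
                PathIn G U u v → PathIn H U u v
path-transfer f (here a)     = here a
path-transfer f (step a e p) = step a (f _ _ a (path-source p) e) (path-transfer f p)

module _ {n : ℕ} (G : Graph n) where

  degreeIn : VSet n → Fin n → ℕ
  degreeIn U v = size (adj G v ∩ U)

  edgesIn : VSet n → ℕ
  edgesIn U = countPairs (λ i j → adj G i j ∧ (U i ∧ U j))

  edgesIn-mono : ∀ {U V} → U ⊆ V → edgesIn U ≤ edgesIn V
  edgesIn-mono {U} {V} s = subst (edgesIn U ≤_) (trans eq (trans (cong (edgesIn V +_) (countPairs-∅ {n})) (+-identityʳ _)))
                             (m≤m+n (edgesIn U) (countPairs rest))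
    where
    rest : Fin n → Fin n → Bool
    rest i j = (adj G i j ∧ (V i ∧ V j)) ∧ not (U i ∧ U j)
    bool : ∀ a u v → (u ≡ true → v ≡ true) → ι (a ∧ u) + ι ((a ∧ v) ∧ not u) ≡ ι (a ∧ v) + 0
    bool false u     v     _ = refl
    bool true  true  v     f rewrite f refl = refl
    bool true  false true  _ = refl
    bool true  false false _ = refl
    eq : edgesIn U + countPairs rest ≡ edgesIn V + countPairs {n} (λ _ _ → false)
    eq = countPairs-additive _ rest _ (λ _ _ → false) λ i j → bool (adj G i j) (U i ∧ U j) (V i ∧ V j)
           λ p → ∧-intro (s i (proj₁ (∧-elim p))) (s j (proj₂ (∧-elim {U i} p)))

  edgesIn-∪ : ∀ U v → U v ≡ false → edgesIn (U ∪⁅ v ⁆) ≡ edgesIn U + degreeIn U v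
  edgesIn-∪ U v Uv = sym (begin
    edgesIn U + size h                  ≡⟨ cong (edgesIn U +_) (countPairs-star v h hv) ⟨
    edgesIn U + countPairs (star v h)   ≡⟨ countPairs-additive (λ i j → adj G i j ∧ (U i ∧ U j)) (star v h) _ (λ _ _ → false) cell ⟩
    edgesIn (U ∪⁅ v ⁆) + countPairs {n} (λ _ _ → false) ≡⟨ cong (edgesIn (U ∪⁅ v ⁆) +_) (countPairs-∅ {n}) ⟩
    edgesIn (U ∪⁅ v ⁆) + 0              ≡⟨ +-identityʳ _ ⟩
    edgesIn (U ∪⁅ v ⁆)                  ∎)
    where
    open ≡-Reasoning
    h : VSet n
    h = adj G v ∩ U
    hv : h v ≡ false
    hv rewrite loopless G v = refl
    cell : ∀ i j → ι (adj G i j ∧ (U i ∧ U j)) + ι (star v h i j)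
                 ≡ ι (adj G i j ∧ ((U ∪⁅ v ⁆) i ∧ (U ∪⁅ v ⁆) j)) + 0
    cell i j with i ≟ v | j ≟ v
    ... | yes refl | yes refl rewrite loopless G v = refl
    ... | yes refl | no _ rewrite Uv = b1 (adj G v j) (U j)
      where
      b1 : ∀ a y → ι (a ∧ false) + ι ((a ∧ y) ∨ false) ≡ ι (a ∧ (y ∨ false)) + 0
      b1 true  true  = refl
      b1 true  false = refl
      b1 false y     = refl
    cell i j | no _ | yes refl rewrite Uv | Graph.sym G i v = b2 (adj G v i) (U i)
      where
      b2 : ∀ a y → ι (a ∧ (y ∧ false)) + ι (a ∧ y) ≡ ι (a ∧ ((y ∨ false) ∧ true)) + 0
      b2 true  true  = refl
      b2 true  false = refl
      b2 false y     = refl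
    cell i j | no _ | no _ = b3 (adj G i j) (U i) (U j)
      where
      b3 : ∀ a y z → ι (a ∧ (y ∧ z)) + 0 ≡ ι (a ∧ ((y ∨ false) ∧ (z ∨ false))) + 0
      b3 false y     z     = refl
      b3 true  false z     = refl
      b3 true  true  true  = refl
      b3 true  true  false = refl

  -- When `v` joins `Y`, its edges to `Y` leave the cut and its edges to the rest enter it; the
  -- additive form avoids subtraction.
  bondSize-∪ : ∀ Y v → Y v ≡ false →
               bondSize G (Y ∪⁅ v ⁆) + degreeIn Y v ≡ bondSize G Y + degreeIn (∁ Y) v
  bondSize-∪ Y v Yv = begin
    bondSize G (Y ∪⁅ v ⁆) + size h  ≡⟨ cong (bondSize G (Y ∪⁅ v ⁆) +_) (countPairs-star v h (hv Y)) ⟨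
    bondSize G (Y ∪⁅ v ⁆) + countPairs (star v h)
      ≡⟨ countPairs-additive (λ i j → adj G i j ∧ ((Y ∪⁅ v ⁆) i xor (Y ∪⁅ v ⁆) j)) (star v h)
                             (λ i j → adj G i j ∧ (Y i xor Y j)) (star v h′) cell ⟩
    bondSize G Y + countPairs (star v h′)  ≡⟨ cong (bondSize G Y +_) (countPairs-star v h′ (hv (∁ Y))) ⟩
    bondSize G Y + size h′          ∎
    where
    open ≡-Reasoning
    h h′ : VSet n
    h  = adj G v ∩ Y
    h′ = adj G v ∩ ∁ Y
    hv : ∀ U → (adj G v ∩ U) v ≡ false
    hv U rewrite loopless G v = refl
    cell : ∀ i j → ι (adj G i j ∧ ((Y ∪⁅ v ⁆) i xor (Y ∪⁅ v ⁆) j)) + ι (star v h i j)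
                 ≡ ι (adj G i j ∧ (Y i xor Y j)) + ι (star v h′ i j)
    cell i j with i ≟ v | j ≟ v
    ... | yes refl | yes refl rewrite loopless G v = refl
    ... | yes refl | no _ rewrite Yv = b1 (adj G v j) (Y j)
      where
      b1 : ∀ a y → ι (a ∧ not (y ∨ false)) + ι ((a ∧ y) ∨ false) ≡ ι (a ∧ y) + ι ((a ∧ not y) ∨ false)
      b1 true  true  = refl
      b1 true  false = refl
      b1 false y     = refl
    cell i j | no _ | yes refl rewrite Yv | Graph.sym G i v = b2 (adj G v i) (Y i)
      where
      b2 : ∀ a y → ι (a ∧ ((y ∨ false) xor true)) + ι (a ∧ y) ≡ ι (a ∧ (y xor false)) + ι (a ∧ not y)
      b2 true  true  = refl
      b2 true  false = refl
      b2 false y     = refl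
    cell i j | no _ | no _ = b3 (adj G i j) (Y i) (Y j)
      where
      b3 : ∀ a y z → ι (a ∧ ((y ∨ false) xor (z ∨ false))) + 0 ≡ ι (a ∧ (y xor z)) + 0
      b3 false y     z     = refl
      b3 true  false true  = refl
      b3 true  false false = refl
      b3 true  true  true  = refl
      b3 true  true  false = refl

  bondSize-∁ : ∀ Y → bondSize G (∁ Y) ≡ bondSize G Y
  bondSize-∁ Y = +-cancelʳ-≡ (countPairs {n} (λ _ _ → false)) _ _
    (countPairs-additive (λ i j → adj G i j ∧ (not (Y i) xor not (Y j))) (λ _ _ → false)
                         (λ i j → adj G i j ∧ (Y i xor Y j)) (λ _ _ → false)
                         λ i j → bool (adj G i j) (Y i) (Y j))
    where
    bool : ∀ a y z → ι (a ∧ (not y xor not z)) + 0 ≡ ι (a ∧ (y xor z)) + 0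
    bool false y     z     = refl
    bool true  true  true  = refl
    bool true  true  false = refl
    bool true  false true  = refl
    bool true  false false = refl

  numEdges-partition : ∀ Y → numEdges G ≡ bondSize G Y + (edgesIn Y + edgesIn (∁ Y))
  numEdges-partition Y = begin
    numEdges G                                 ≡⟨ +-identityʳ _ ⟨
    numEdges G + 0                             ≡⟨ cong (numEdges G +_) (countPairs-∅ {n}) ⟨
    numEdges G + countPairs {n} (λ _ _ → false)
      ≡⟨ countPairs-additive (adj G) (λ _ _ → false) _ same
           (λ i j → b1 (adj G i j) (Y i) (Y j)) ⟩
    bondSize G Y + countPairs same             ≡⟨ cong (bondSize G Y +_) split ⟩
    bondSize G Y + (edgesIn Y + edgesIn (∁ Y)) ∎
    where
    open ≡-Reasoning
    same : Fin n → Fin n → Bool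
    same i j = adj G i j ∧ not (Y i xor Y j)
    b1 : ∀ a y z → ι a + 0 ≡ ι (a ∧ (y xor z)) + ι (a ∧ not (y xor z))
    b1 false y     z     = refl
    b1 true  true  true  = refl
    b1 true  true  false = refl
    b1 true  false true  = refl
    b1 true  false false = refl
    b2 : ∀ a y z → ι (a ∧ not (y xor z)) + 0 ≡ ι (a ∧ (y ∧ z)) + ι (a ∧ (not y ∧ not z))
    b2 false y     z     = refl
    b2 true  true  true  = refl
    b2 true  true  false = refl
    b2 true  false true  = refl
    b2 true  false false = refl
    split : countPairs same ≡ edgesIn Y + edgesIn (∁ Y)
    split = begin
      countPairs same                                  ≡⟨ +-identityʳ _ ⟨
      countPairs same + 0                              ≡⟨ cong (countPairs same +_) (countPairs-∅ {n}) ⟨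
      countPairs same + countPairs {n} (λ _ _ → false)
        ≡⟨ countPairs-additive same (λ _ _ → false) (λ i j → adj G i j ∧ (Y i ∧ Y j))
             (λ i j → adj G i j ∧ (∁ Y i ∧ ∁ Y j)) (λ i j → b2 (adj G i j) (Y i) (Y j)) ⟩
      edgesIn Y + edgesIn (∁ Y)                        ∎

  -- Greedy search carrying an invariant `P`; the number of vertices of `U` not yet reached bounds
  -- the rounds. One search thus yields both components and the edge bound for connected sets.
  grow : ∀ (U : VSet n) (P : VSet n → Set) →
         (∀ T p q → P T → T p ≡ true → U q ≡ true → T q ≡ false → adj G p q ≡ true → P (T ∪⁅ q ⁆)) →
         ∀ T → P T → T ⊆ U → ∃ λ T′ → P T′ × T ⊆ T′ × T′ ⊆ U × Closed {G = G} U T′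
  grow U P extend T₀ P₀ T₀⊆U = go (size (U ∩ ∁ T₀)) T₀ ≤-refl P₀ T₀⊆U
    where
    go : ∀ k T → size (U ∩ ∁ T) ≤ k → P T → T ⊆ U →
         ∃ λ T′ → P T′ × T ⊆ T′ × T′ ⊆ U × Closed {G = G} U T′
    go k T le PT T⊆U
      with any? (λ p → any? (λ q → (T p ≟ᵇ true) ×-dec (U q ≟ᵇ true) ×-dec (T q ≟ᵇ false) ×-dec (adj G p q ≟ᵇ true)))
    ... | no none = T , PT , (λ _ → id) , T⊆U , closed
      where
      closed : Closed {G = G} U T
      closed p q Tp Uq e with T q in Tq
      ... | true  = refl
      ... | false = contradiction (p , q , Tp , Uq , Tq , e) none
    go zero T le PT T⊆U | yes (p , q , Tp , Uq , Tq , e)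
      with () ← ≤-trans (length≤size (U ∩ ∁ T) ([] ∷ []) (∧-intro Uq (not-false Tq) ∷ [])) le
    go (suc k) T le PT T⊆U | yes (p , q , Tp , Uq , Tq , e)
      with go k (T ∪⁅ q ⁆) smaller (extend T p q PT Tp Uq Tq e) sub
      where
      sub : (T ∪⁅ q ⁆) ⊆ U
      sub x m with ∪⁻ T q m
      ... | inj₁ Tx   = T⊆U x Tx
      ... | inj₂ refl = Uq
      shrink : (U ∩ ∁ (T ∪⁅ q ⁆)) ⊆ ((U ∩ ∁ T) ∖⁅ q ⁆)
      shrink x m with ∧-elim {U x} m
      ... | Ux , m′ with ∪∁⁻ T q (not-true m′)
      ...   | Tx , x≢q = ∖⁺ (U ∩ ∁ T) q (∧-intro Ux (not-false Tx)) x≢q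
      smaller : size (U ∩ ∁ (T ∪⁅ q ⁆)) ≤ k
      smaller = ≤-pred (≤-trans (s≤s (size-mono shrink))
        (≤-trans (≤-reflexive (sym (size-∖ (U ∩ ∁ T) q (∧-intro Uq (not-false Tq))))) le))
    ... | T′ , PT′ , T⊆T′ , T′⊆U , closed = T′ , PT′ , (λ x m → T⊆T′ x (∪⁺ˡ {U = T} q m)) , T′⊆U , closed

  ⁅⁆⊆ : ∀ {U : VSet n} {r} → U r ≡ true → (_≡ᵇ r) ⊆ U
  ⁅⁆⊆ {r = r} Ur x m with x ≟ r
  ... | yes refl = Ur

  component : ∀ U r → U r ≡ true →
              ∃ λ D → D r ≡ true × D ⊆ U × Closed {G = G} U D × ConnectedOn G D
  component U r Ur
    -- The paths are kept inside `T` rather than `U`, so that the final set is connected by itself.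
    with grow U (λ T → ∀ x → T x ≡ true → PathIn G T r x) extend (_≡ᵇ r) start (⁅⁆⊆ {U} Ur)
    where
    start : ∀ x → x ≡ᵇ r ≡ true → PathIn G (_≡ᵇ r) r x
    start x m with x ≟ r in eq
    ... | yes refl = here (≡ᵇ-refl r)
    extend : ∀ T p q → (∀ x → T x ≡ true → PathIn G T r x) → T p ≡ true → U q ≡ true → T q ≡ false →
             adj G p q ≡ true → ∀ x → (T ∪⁅ q ⁆) x ≡ true → PathIn G (T ∪⁅ q ⁆) r x
    extend T p q paths Tp _ _ e x m with ∪⁻ T q m
    ... | inj₁ Tx   = path-mono (λ y → ∪⁺ˡ {U = T} q) (paths x Tx)
    ... | inj₂ refl = path-trans (path-mono (λ y → ∪⁺ˡ {U = T} q) (paths p Tp))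
                                 (step (∪⁺ˡ {U = T} q Tp) e (here (∪⁺ʳ T q)))
  ... | D , paths , r⊆D , D⊆U , closed =
    D , r⊆D r (≡ᵇ-refl r) , D⊆U , closed , connected-from r paths

  -- Each vertex added to a growing set brings at least one edge back to it, as in a spanning tree;
  -- the set stops growing only when it is all of `U`.
  spanning-edges : ∀ U r → U r ≡ true → (∀ x → U x ≡ true → PathIn G U r x) → size U ≤ suc (edgesIn U)
  spanning-edges U r Ur conn
    with grow U (λ T → size T ≤ suc (edgesIn T)) extend (_≡ᵇ r) start (⁅⁆⊆ {U} Ur)
    where
    start : size (_≡ᵇ r) ≤ suc (edgesIn (_≡ᵇ r))
    start = ≤-trans (≤-reflexive (size-⁅⁆ r)) (s≤s z≤n)
    extend : ∀ T p q → size T ≤ suc (edgesIn T) → T p ≡ true → U q ≡ true → T q ≡ false →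
             adj G p q ≡ true → size (T ∪⁅ q ⁆) ≤ suc (edgesIn (T ∪⁅ q ⁆))
    extend T p q le Tp _ Tq e = begin
      size (T ∪⁅ q ⁆)                   ≡⟨ size-∪ T q Tq ⟩
      suc (size T)                      ≤⟨ s≤s le ⟩
      suc (suc (edgesIn T))             ≡⟨ cong suc (+-comm 1 (edgesIn T)) ⟩
      suc (edgesIn T + 1)               ≤⟨ s≤s (+-monoʳ-≤ (edgesIn T) deg) ⟩
      suc (edgesIn T + degreeIn T q)    ≡⟨ cong suc (edgesIn-∪ T q Tq) ⟨
      suc (edgesIn (T ∪⁅ q ⁆))          ∎
      where
      open ≤-Reasoning
      deg : 1 ≤ degreeIn T q
      deg = length≤size (adj G q ∩ T) ([] ∷ []) (∧-intro (adj-sym {G = G} e) Tp ∷ [])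
  ... | T , le , r⊆T , T⊆U , closed = begin
    size U            ≤⟨ size-mono (λ x Ux → path-target (path-in-closed closed (r⊆T r (≡ᵇ-refl r)) (conn x Ux))) ⟩
    size T            ≤⟨ le ⟩
    suc (edgesIn T)   ≤⟨ s≤s (edgesIn-mono T⊆U) ⟩
    suc (edgesIn U)   ∎
    where open ≤-Reasoning

-- Deleting an edge

sameEdge : ∀ {n} → Fin n → Fin n → Fin n → Fin n → Bool
sameEdge u v = star u (_≡ᵇ v)

OffEdge : ∀ {n} → Fin n → Fin n → Fin n → Fin n → Set
OffEdge u v x y = ¬ (x ≡ u × y ≡ v) × ¬ (x ≡ v × y ≡ u)

off⇒sameEdge : ∀ {n} {u v x y : Fin n} → OffEdge u v x y → sameEdge u v x y ≡ false
off⇒sameEdge {u = u} {v} {x} {y} (p , q) with x ≟ u | y ≟ v | y ≟ u | x ≟ v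
... | yes a | yes b | _     | _     = contradiction (a , b) p
... | _     | _     | yes c | yes d = contradiction (d , c) q
... | yes _ | no _  | yes _ | no _  = refl
... | yes _ | no _  | no _  | _     = refl
... | no _  | _     | yes _ | no _  = refl
... | no _  | _     | no _  | _     = refl

sameEdge⇒ : ∀ {n} (u v x y : Fin n) → sameEdge u v x y ≡ true → (x ≡ u × y ≡ v) ⊎ (x ≡ v × y ≡ u)
sameEdge⇒ u v x y e with x ≟ u | y ≟ v | y ≟ u | x ≟ v
... | yes a | yes b | _     | _     = inj₁ (a , b)
... | yes a | no _  | yes c | yes d = inj₂ (d , c)
... | no _  | _     | yes c | yes d = inj₂ (d , c)

delete : ∀ {n} → Graph n → Fin n → Fin n → Graph n
delete G u v = record
  { adj = λ x y → adj G x y ∧ not (sameEdge u v x y)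
  ; sym = λ x y → cong₂ (λ a b → a ∧ not b) (Graph.sym G x y) (swap x y)
  ; loopless = λ x → cong (_∧ not (sameEdge u v x x)) (loopless G x)
  }
  where
  swap : ∀ x y → sameEdge u v x y ≡ sameEdge u v y x
  swap x y = ∨-comm (x ≡ᵇ u ∧ y ≡ᵇ v) _

delete-keeps : ∀ {n} (G : Graph n) {u v x y} → adj G x y ≡ true → OffEdge u v x y →
               adj (delete G u v) x y ≡ true
delete-keeps G e off = ∧-intro e (not-false (off⇒sameEdge off))

-- `sameEdge u v` is a star with one leaf, so exactly one listed pair disappears, whatever the order
-- of `u` and `v`.
edgesIn-delete : ∀ {n} (G : Graph n) {u v} U → adj G u v ≡ true → U u ≡ true → U v ≡ true →
                 edgesIn G U ≡ suc (edgesIn (delete G u v) U)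
edgesIn-delete {n} G {u} {v} U e Uu Uv = sym (begin
  suc (edgesIn (delete G u v) U)                 ≡⟨ +-comm 1 _ ⟩
  edgesIn (delete G u v) U + 1                   ≡⟨ cong (edgesIn (delete G u v) U +_) (size-⁅⁆ v) ⟨
  edgesIn (delete G u v) U + size (_≡ᵇ v)
    ≡⟨ cong (edgesIn (delete G u v) U +_) (countPairs-star u (_≡ᵇ v) (≢⇒≡ᵇ (adj⇒≢ {G = G} e))) ⟨
  edgesIn (delete G u v) U + countPairs (sameEdge u v)
    ≡⟨ countPairs-additive _ (sameEdge u v) _ (λ _ _ → false)
         (λ i j → bool (adj G i j) (sameEdge u v i j) (U i ∧ U j) (isEdge i j)) ⟩
  edgesIn G U + countPairs {n} (λ _ _ → false)   ≡⟨ cong (edgesIn G U +_) (countPairs-∅ {n}) ⟩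
  edgesIn G U + 0                                ≡⟨ +-identityʳ _ ⟩
  edgesIn G U                                    ∎)
  where
  open ≡-Reasoning
  bool : ∀ a e u → (e ≡ true → a ≡ true × u ≡ true) → ι ((a ∧ not e) ∧ u) + ι e ≡ ι (a ∧ u) + 0
  bool a true u f with f refl
  ... | refl , refl = refl
  bool true  false u _ = refl
  bool false false u _ = refl
  isEdge : ∀ i j → sameEdge u v i j ≡ true → adj G i j ≡ true × U i ∧ U j ≡ true
  isEdge i j s with sameEdge⇒ u v i j s
  ... | inj₁ (refl , refl) = e , ∧-intro Uu Uv
  ... | inj₂ (refl , refl) = adj-sym {G = G} e , ∧-intro Uv Uu

-- Walks and local surgery on longest cycles

-- The list holds the inner vertices only, so a cycle through `a` is a walk from `a` to `a`. The
-- relation is arbitrary: besides adjacency it also expresses that no step uses a given edge, or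
-- that no step changes sides.
Walk : ∀ {A : Set} → (A → A → Set) → A → List A → A → Set
Walk R u []       v = R u v
Walk R u (x ∷ xs) v = R u x × Walk R x xs v

module _ {A : Set} {R : A → A → Set} where

  walk-++ : ∀ {u v w} xs {ys} → Walk R u xs v → Walk R v ys w → Walk R u (xs ++ v ∷ ys) w
  walk-++ []       p       q = p , q
  walk-++ (x ∷ xs) (r , p) q = r , walk-++ xs p q

  walk-split : ∀ {u v w} xs {ys} → Walk R u (xs ++ v ∷ ys) w → Walk R u xs v × Walk R v ys w
  walk-split []       (p , q) = p , q
  walk-split (x ∷ xs) (r , p) with walk-split xs p
  ... | q , q′ = (r , q) , q′

  walk-rotate : ∀ {u v} xs {ys} → Walk R u (xs ++ v ∷ ys) u → Walk R v (ys ++ u ∷ xs) v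
  walk-rotate xs {ys} p with walk-split xs p
  ... | q , q′ = walk-++ ys q′ q

  walk-reverse : (∀ {x y} → R x y → R y x) → ∀ {u v} xs → Walk R u xs v → Walk R v (reverse xs) u
  walk-reverse s []       p = s p
  walk-reverse s (x ∷ xs) (r , p) rewrite unfold-reverse x xs =
    walk-++ (reverse xs) (walk-reverse s xs p) (s r)

  walk-all : ∀ {P : A → Set} → (∀ {x y} → P x → P y → R x y) →
             ∀ {u v} xs → P u → All P xs → P v → Walk R u xs v
  walk-all f []       a []       c = f a c
  walk-all f (x ∷ xs) a (b ∷ bs) c = f a b , walk-all f xs b bs c

  walk⇒all : ∀ {u v} xs → Walk R u xs v → All (λ p → R (proj₁ p) (proj₂ p)) (zip (u ∷ xs) (xs ++ [ v ]))
  walk⇒all []       p       = p ∷ []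
  walk⇒all (x ∷ xs) (r , p) = r ∷ walk⇒all xs p

  all⇒walk : ∀ {u v} xs → All (λ p → R (proj₁ p) (proj₂ p)) (zip (u ∷ xs) (xs ++ [ v ])) → Walk R u xs v
  all⇒walk []       (p ∷ []) = p
  all⇒walk (x ∷ xs) (r ∷ ps) = r , all⇒walk xs ps

walk-zip : ∀ {A : Set} {R S T : A → A → Set} → (∀ {x y} → R x y → S x y → T x y) →
           ∀ {u v} xs → Walk R u xs v → Walk S u xs v → Walk T u xs v
walk-zip f []       p       q       = f p q
walk-zip f (x ∷ xs) (r , p) (s , q) = f r s , walk-zip f xs p q

walk-const : ∀ {A B : Set} {f : A → B} {u v} xs → Walk (λ x y → f x ≡ f y) u xs v → All (λ x → f x ≡ f u) xs
walk-const []       p       = []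
walk-const (x ∷ xs) (r , p) = sym r ∷ All.map (λ e → trans e (sym r)) (walk-const xs p)

module _ {n : ℕ} (G : Graph n) where

  Edge : Fin n → Fin n → Set
  Edge u v = adj G u v ≡ true

  walk-connects : ∀ {U u v} xs → Walk Edge u xs v → U u ≡ true → All (λ x → U x ≡ true) xs →
                  ∀ {x} → x ∈ u ∷ xs → PathIn G U u x
  walk-connects xs       p       a bs       (here refl)  = here a
  walk-connects (y ∷ ys) (e , p) a (b ∷ bs) (there x∈ys) = step a e (walk-connects ys p b bs x∈ys)

  walk-path : ∀ {U u v} xs → Walk Edge u xs v → U u ≡ true → All (λ x → U x ≡ true) xs → U v ≡ true → PathIn G U u v
  walk-path []       e       a []       c = step a e (here c)
  walk-path (y ∷ ys) (e , p) a (b ∷ bs) c = step a e (walk-path ys p b bs c)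

  data SimplePath (U : VSet n) : Fin n → Fin n → List (Fin n) → Set where
    single : ∀ {u} → U u ≡ true → SimplePath U u u [ u ]
    cons   : ∀ {u w v P} → U u ≡ true → Edge u w → SimplePath U w v P → u ∉ P → SimplePath U u v (u ∷ P)

  suffix : ∀ {U u v P x} → SimplePath U u v P → x ∈ P → ∃ (SimplePath U x v)
  suffix (single a)       (here refl) = _ , single a
  suffix (cons a e p u∉P) (here refl) = _ , cons a e p u∉P
  suffix (cons _ _ p _) (there x∈P) = suffix p x∈P

  simplify : ∀ {U u v} → PathIn G U u v → ∃ (SimplePath U u v)
  simplify (here a) = _ , single a
  simplify (step {u} a e p) with simplify p
  ... | P , q with _∈?_ _≟_ u P
  ...   | yes u∈P = suffix q u∈P
  ...   | no  u∉P = u ∷ P , cons a e q u∉P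

  simple-unique : ∀ {U u v P} → SimplePath U u v P → Unique P
  simple-unique (single _)         = [] ∷ []
  simple-unique (cons _ _ p u∉P) = ¬Any⇒All¬ _ u∉P ∷ simple-unique p

  simple-all : ∀ {U u v P} → SimplePath U u v P → All (λ x → U x ≡ true) P
  simple-all (single a)     = a ∷ []
  simple-all (cons a _ p _) = a ∷ simple-all p

  simple-walk : ∀ {U u v P a b} → Edge a u → SimplePath U u v P → Edge v b → Walk Edge a P b
  simple-walk e (single _)      e′ = e , e′
  simple-walk e (cons _ f p _) e′ = e , simple-walk f p e′

  simple-nonempty : ∀ {U u v P} → SimplePath U u v P → 1 ≤ length P
  simple-nonempty (single _)     = s≤s z≤n
  simple-nonempty (cons _ _ _ _) = s≤s z≤n

  Attached : VSet n → Fin n → Set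
  Attached D a = ∃ λ d → D d ≡ true × Edge a d

  attached? : ∀ D a → Dec (Attached D a)
  attached? D a = any? λ d → (D d ≟ᵇ true) ×-dec (adj G a d ≟ᵇ true)

  -- That `P` has at least one vertex is what makes rerouted cycles strictly longer.
  bypass : ∀ {D a b} → ConnectedOn G D → Attached D a → Attached D b →
           ∃ λ P → Unique P × All (λ x → D x ≡ true) P × 1 ≤ length P × Walk Edge a P b
  bypass conn (d , Dd , e) (d′ , Dd′ , e′) with simplify (conn d d′ Dd Dd′)
  ... | P , p = P , simple-unique p , simple-all p , simple-nonempty p , simple-walk e p (adj-sym {G = G} e′)

  -- Rotating the list leaves the vertex set `K` alone, so facts stated through `K` survive every
  -- choice of starting vertex.
  record LongestCycleOn (K : VSet n) (vs : List (Fin n)) : Set where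
    field
      longest  : IsLongestCycle G vs
      sound    : ∀ {x} → x ∈ vs → K x ≡ true
      complete : ∀ {x} → K x ≡ true → x ∈ vs

    length≥3 : 3 ≤ length vs
    length≥3 = proj₁ (proj₁ longest)

    unique : Unique vs
    unique = proj₁ (proj₂ (proj₁ longest))

    not-longer : ∀ {vs′} → IsCycle G vs′ → length vs < length vs′ → ⊥
    not-longer cyc lt = <⇒≱ lt (proj₂ longest _ cyc)

  open LongestCycleOn public

  module _ {K : VSet n} where

    lc-walk : ∀ {a vs} → LongestCycleOn K (a ∷ vs) → Walk Edge a vs a
    lc-walk lc = all⇒walk _ (proj₂ (proj₂ (proj₁ (longest lc))))

    rotate : ∀ {u v} xs {ys} → LongestCycleOn K (u ∷ xs ++ v ∷ ys) → LongestCycleOn K (v ∷ ys ++ u ∷ xs)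
    rotate {u} {v} xs {ys} lc = record
      { longest  = (subst (3 ≤_) same (length≥3 lc)
                   , Unique-resp-↭ (setoid _) (↭⇒↭ₛ perm) (unique lc)
                   , walk⇒all (ys ++ u ∷ xs) (walk-rotate xs (lc-walk lc)))
                 , λ C′ cyc → subst (length C′ ≤_) same (proj₂ (longest lc) C′ cyc)
      ; sound    = λ m → sound lc (∈-resp-↭ (↭-sym perm) m)
      ; complete = λ m → ∈-resp-↭ perm (complete lc m)
      }
      where
      perm : u ∷ xs ++ v ∷ ys ↭ v ∷ ys ++ u ∷ xs
      perm = ++-comm (u ∷ xs) (v ∷ ys)
      same : length (u ∷ xs ++ v ∷ ys) ≡ length (v ∷ ys ++ u ∷ xs)
      same = ↭-length perm

    rotate-to : ∀ {vs a} → LongestCycleOn K vs → K a ≡ true → ∃ λ rest → LongestCycleOn K (a ∷ rest)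
    rotate-to lc Ka with ∈-∃++ (complete lc Ka)
    ... | []     , ys , refl = ys , lc
    ... | x ∷ xs , ys , refl = ys ++ x ∷ xs , rotate xs lc

    -- The closed walk would be a longer cycle. Its vertices are those of the old cycle and the new
    -- ones in another order, so the permutation alone shows that none repeats.
    no-insertion : ∀ {vs ws a rest} → LongestCycleOn K vs → Unique ws → All (λ x → K x ≡ false) ws →
                   1 ≤ length ws → ws ++ vs ↭ a ∷ rest → Walk Edge a rest a → ⊥
    no-insertion {vs} {ws} {a} {rest} lc uws out ne perm walk =
      not-longer lc (≤-trans (length≥3 lc) (<⇒≤ longer) , uniq , walk⇒all rest walk) longer
      where
      longer : length vs < length (a ∷ rest)
      longer = begin
        suc (length vs)            ≤⟨ +-monoˡ-≤ (length vs) ne ⟩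
        length ws + length vs      ≡⟨ length-++ ws ⟨
        length (ws ++ vs)          ≡⟨ ↭-length perm ⟩
        length (a ∷ rest)          ∎
        where open ≤-Reasoning
      uniq : Unique (a ∷ rest)
      uniq = Unique-resp-↭ (setoid _) (↭⇒↭ₛ perm)
        (Unique-++⁺ uws (unique lc) λ (p , q) → true≢false (sound lc q) (All.lookup out p))

    module _ {D : VSet n} (conn : ConnectedOn G D) (D∌K : ∀ x → D x ≡ true → K x ≡ false) where

      -- Otherwise a detour through `D` could replace the cycle edge from `a` to `b`.
      no-consecutive : ∀ {a b rest} → LongestCycleOn K (a ∷ b ∷ rest) → Attached D a → Attached D b → ⊥
      no-consecutive {a} {b} {rest} lc atta attb with bypass conn atta attb
      ... | P , uP , inD , ne , w =
        no-insertion lc uP (All.map (D∌K _) inD) ne (shift a P (b ∷ rest)) (walk-++ P w (proj₂ (lc-walk lc)))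

      -- The two attached vertices and the link between their successors s and t give the longer
      -- cycle a P b … s Q t … a, whose middle part traverses the cycle backwards.
      no-crossing : ∀ {a s b t} xs {ys} Q → LongestCycleOn K (a ∷ s ∷ xs ++ b ∷ t ∷ ys) →
                    Attached D a → Attached D b → Unique Q → All (λ x → K x ≡ false × D x ≡ false) Q →
                    Walk Edge s Q t → ⊥
      no-crossing {a} {s} {b} {t} xs {ys} Q lc atta attb uQ outQ wQ with bypass conn atta attb
      ... | P , uP , inD , ne , wP =
        no-insertion {ws = P ++ Q} lc
          (Unique-++⁺ uP uQ λ (p , q) → true≢false (All.lookup inD p) (proj₂ (All.lookup outQ q)))
          (++⁺ (All.map (D∌K _) inD) (All.map proj₁ outQ))
          (≤-trans ne (≤-trans (m≤m+n _ _) (≤-reflexive (sym (length-++ P)))))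
          -- The new cycle runs backwards through `xs`, so `xs` is exchanged for its reverse before
          -- the blocks are reordered.
          (↭-trans (↭-++⁺ˡ (P ++ Q) (↭-++⁺ˡ (a ∷ s ∷ []) (↭-++⁺ʳ (b ∷ t ∷ ys) (↭-sym (↭-reverse xs)))))
                   (rearrange (reverse xs)))
          (walk-++ P wP (walk-++ (reverse xs) (walk-reverse (adj-sym {G = G}) xs s-b) (walk-++ Q wQ t-a)))
        where
        s-b : Walk Edge s xs b
        s-b = proj₁ (walk-split xs (proj₂ (lc-walk lc)))
        t-a : Walk Edge t ys a
        t-a = proj₂ (proj₂ (walk-split xs (proj₂ (lc-walk lc))))
        rearrange : ∀ zs → (P ++ Q) ++ a ∷ s ∷ zs ++ b ∷ t ∷ ys ↭ a ∷ P ++ b ∷ zs ++ s ∷ Q ++ t ∷ ys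
        rearrange zs = prove 8
          ((var 0F ⊕ var 1F) ⊕ (var 2F ⊕ (var 3F ⊕ (var 4F ⊕ (var 5F ⊕ (var 6F ⊕ var 7F))))))
          (var 2F ⊕ (var 0F ⊕ (var 5F ⊕ (var 4F ⊕ (var 3F ⊕ (var 1F ⊕ (var 6F ⊕ var 7F)))))))
          (P ∷ᵛ Q ∷ᵛ [ a ] ∷ᵛ [ s ] ∷ᵛ zs ∷ᵛ [ b ] ∷ᵛ [ t ] ∷ᵛ ys ∷ᵛ []ᵛ)
          where open CommutativeMonoidSolver (++-commutativeMonoid {A = Fin n})

    -- Replacing `b` by `y` and `y′` lengthens the cycle by one. Since a cycle vertex is skipped,
    -- the detour needs two vertices.
    no-detour : ∀ {a b c rest y y′} → LongestCycleOn K (a ∷ b ∷ c ∷ rest) → K y ≡ false → K y′ ≡ false →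
                Edge a y → Edge y y′ → Edge y′ c → ⊥
    no-detour {a} {b} {c} {rest} {y} {y′} lc Ky Ky′ e e′ e″ with unique lc
    ... | (_ ∷ a∉) ∷ _ ∷ u =
      not-longer lc (s≤s (s≤s (s≤s z≤n)) , uniq , walk⇒all (y ∷ y′ ∷ c ∷ rest) (e , e′ , e″ , proj₂ (proj₂ (lc-walk lc))))
                 ≤-refl
      where
      outside : ∀ {y x} → K y ≡ false → K x ≡ true → y ≢ x
      outside p q refl = true≢false q p
      inK : ∀ {x} → x ∈ c ∷ rest → K x ≡ true
      inK m = sound lc (there (there m))
      uniq : Unique (a ∷ y ∷ y′ ∷ c ∷ rest)
      uniq = ((outside Ky (sound lc (here refl)) ∘ sym) ∷ (outside Ky′ (sound lc (here refl)) ∘ sym) ∷ a∉)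
           ∷ (adj⇒≢ {G = G} e′ ∷ All.tabulate λ m → outside Ky (inK m))
           ∷ All.tabulate (λ m → outside Ky′ (inK m))
           ∷ u

-- A bond with few edges outside it

module _ {n : ℕ} (G : Graph n) (3-connected : KConnected 3 G) where

  -- `p` and `q` may coincide, so the same set also serves to delete a single vertex.
  pair : Fin n → Fin n → VSet n
  pair p q = (_≡ᵇ p) ∪⁅ q ⁆

  ∉pair : ∀ p q {x} → x ≢ p → x ≢ q → pair p q x ≡ false
  ∉pair p q x≢p x≢q = ∪∁⁺ (_≡ᵇ p) q (≢⇒≡ᵇ x≢p) x≢q

  ∉pair⁻ : ∀ p q {x} → pair p q x ≡ false → x ≢ p × x ≢ q
  ∉pair⁻ p q m with ∪∁⁻ (_≡ᵇ p) q m
  ... | x≡ᵇp , x≢q = (λ { refl → true≢false (≡ᵇ-refl p) x≡ᵇp }) , x≢q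

  pair-small : ∀ p q → size (pair p q) < 3
  pair-small p q = s≤s (size≤length (pair p q) (p ∷ q ∷ []) λ x m → member x (∪⁻ (_≡ᵇ p) q m))
    where
    member : ∀ x → x ≡ᵇ p ≡ true ⊎ x ≡ q → x ∈ p ∷ q ∷ []
    member x (inj₂ refl) = there (here refl)
    member x (inj₁ m) with x ≟ p
    ... | yes refl = here refl

  reroute : ∀ p q {u v} → u ≢ p → u ≢ q → v ≢ p → v ≢ q → PathIn G (∁ (pair p q)) u v
  reroute p q u≢p u≢q v≢p v≢q = proj₂ 3-connected (pair p q) (pair-small p q) _ _
    (not-false (∉pair p q u≢p u≢q)) (not-false (∉pair p q v≢p v≢q))

  connected : ∀ u v → PathIn G (λ _ → true) u v
  connected u v = path-mono (λ _ _ → refl) (proj₂ 3-connected (λ _ → false)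
    (subst (_< 3) (sym (size-∅ {n} (λ _ → false) λ _ → refl)) (s≤s z≤n)) u v refl refl)

  -- The vertex `x` survives the deletion of `p` and `q`; a path from `s` to it begins with the
  -- desired edge.
  neighbour-avoiding : ∀ {s p q x} → s ≢ p → s ≢ q → x ≢ s → x ≢ p → x ≢ q →
                       ∃ λ z → adj G s z ≡ true × z ≢ p × z ≢ q
  neighbour-avoiding {s} {p} {q} s≢p s≢q x≢s x≢p x≢q
    with path-neighbour (x≢s ∘ sym) (reroute p q s≢p s≢q x≢p x≢q)
  ... | z , z∉ , e = z , e , ∉pair⁻ p q (not-true z∉)

  module _ {K : VSet n} where

    outside≢ : ∀ {x y} → K x ≡ false → K y ≡ true → x ≢ y
    outside≢ p q refl = true≢false q p

    -- The path from `y` to `c` avoiding `p` and `q` must leave `D`, and since `D` is closed it can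
    -- do so only into `K`. Varying `p` and `q` produces different attachments.
    attachment-avoiding : ∀ {D y c p q} → Closed {G = G} (∁ K) D → D y ≡ true →
                          K y ≡ false → K p ≡ true → K q ≡ true → K c ≡ true → D c ≡ false → c ≢ p → c ≢ q →
                          ∃ λ a → K a ≡ true × a ≢ p × a ≢ q × Attached G D a
    attachment-avoiding {D} {y} {c} {p} {q} closed Dy Ky Kp Kq Kc Dc c≢p c≢q
      with path-exit D Dy Dc (reroute p q (outside≢ Ky Kp) (outside≢ Ky Kq) c≢p c≢q)
    ... | d , a , Dd , Da , a∉ , e with K a in Ka
    ...   | true  = a , Ka , proj₁ (∉pair⁻ p q (not-true a∉)) , proj₂ (∉pair⁻ p q (not-true a∉))
                  , d , Dd , adj-sym {G = G} e
    ...   | false = ⊥-elim (true≢false (closed d a Dd (not-false Ka) e) Da)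

    some-attachment : ∀ {D y vs} → Closed {G = G} (∁ K) D → D y ≡ true → K y ≡ false →
                      (∀ x → K x ≡ true → D x ≡ false) → LongestCycleOn G K vs →
                      ∃ λ a → K a ≡ true × Attached G D a
    some-attachment {vs = []} _ _ _ _ lc with () ← length≥3 lc
    some-attachment {vs = _ ∷ []} _ _ _ _ lc with s≤s () ← length≥3 lc
    some-attachment {vs = u ∷ v ∷ vs} closed Dy Ky K∌D lc with unique lc
    ... | (u≢v ∷ _) ∷ _
      with attachment-avoiding closed Dy Ky (sound lc (here refl)) (sound lc (here refl))
             (sound lc (there (here refl))) (K∌D v (sound lc (there (here refl)))) (u≢v ∘ sym) (u≢v ∘ sym)
    ...   | a , Ka , _ , _ , att = a , Ka , att

    -- The cycle uses the edges from `s` to its two cycle neighbours; a third neighbour `z`, on the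
    -- cycle or off it, gives an edge that no step of the cycle uses.
    chord : ∀ {y a s rest} → K y ≡ false → LongestCycleOn G K (a ∷ s ∷ rest) →
            ∃ λ z → adj G s z ≡ true × Walk (OffEdge s z) a (s ∷ rest) a
    chord {rest = []} Ky lc with s≤s (s≤s ()) ← length≥3 lc
    chord {y} {a} {s} {t ∷ rest} Ky lc with unique lc
    ... | (a≢s ∷ a≢t ∷ _) ∷ (s≢t ∷ s∉) ∷ _
      with neighbour-avoiding {s} {a} {t} {y} (a≢s ∘ sym) s≢t
             (outside≢ Ky (sound lc (there (here refl)))) (outside≢ Ky (sound lc (here refl)))
             (outside≢ Ky (sound lc (there (there (here refl)))))
    ...   | z , e , z≢a , z≢t = z , e
          , ((λ (p , _) → a≢s p) , (λ (p , _) → z≢a (sym p)))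
          , ((λ (_ , q) → z≢t (sym q)) , (λ (_ , q) → s≢t (sym q)))
          , walk-all {P = λ x → x ≢ s} (λ x≢s y≢s → (λ (p , _) → x≢s p) , (λ (_ , q) → y≢s q))
                     rest (s≢t ∘ sym) (All.map (λ p → p ∘ sym) s∉) a≢s

  triple : ∀ {A : Set} → A → A → A → Fin 3 → A
  triple a b c 0F = a
  triple a b c 1F = b
  triple a b c 2F = c

  triple-elim : ∀ {P : Fin 3 → Set} → P 0F → P 1F → P 2F → ∀ i → P i
  triple-elim a b c 0F = a
  triple-elim a b c 1F = b
  triple-elim a b c 2F = c

  offEdge-sym : ∀ {u v x y : Fin n} → OffEdge u v x y → OffEdge x y u v
  offEdge-sym (p , q) = (λ { (refl , refl) → p (refl , refl) }) , (λ { (refl , refl) → q (refl , refl) })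

  -- `X` is the side of the bond containing the cycle. The component `D` contains the other side,
  -- but may also reach into `X`.
  module CycleInSide {K X D : VSet n} {y : Fin n} {vs : List (Fin n)}
    (cycle : LongestCycleOn G K vs) (K⊆X : K ⊆ X) (X-connected : ConnectedOn G X)
    (∁X⊆D : ∀ x → X x ≡ false → D x ≡ true) (Dy : D y ≡ true) (D⊆∁K : D ⊆ ∁ K)
    (D-closed : Closed {G = G} (∁ K) D) (D-connected : ConnectedOn G D) where

    D∌K : ∀ x → D x ≡ true → K x ≡ false
    D∌K x Dx = not-true (D⊆∁K x Dx)

    K∌D : ∀ {x} → K x ≡ true → D x ≡ false
    K∌D {x} Kx with D x in Dx
    ... | false = refl
    ... | true  = ⊥-elim (true≢false Kx (D∌K x Dx))

    Ky : K y ≡ false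
    Ky = D∌K y Dy

    unattached-successor : ∀ {a b rest} → LongestCycleOn G K (a ∷ b ∷ rest) → Attached G D a → ¬ Attached G D b
    unattached-successor = no-consecutive G D-connected D∌K

    -- The shape of the list makes the attachments and their successors six different vertices.
    ThreeAttachments : Set
    ThreeAttachments = ∃₂ λ a₁ s₁ → ∃₂ λ a₂ s₂ → ∃₂ λ a₃ s₃ → ∃₂ λ xs ys → ∃ λ zs →
      LongestCycleOn G K (a₁ ∷ s₁ ∷ xs ++ a₂ ∷ s₂ ∷ ys ++ a₃ ∷ s₃ ∷ zs) ×
      Attached G D a₁ × Attached G D a₂ × Attached G D a₃

    place : ∀ {a s p q} xs ys zs → LongestCycleOn G K (a ∷ s ∷ xs ++ p ∷ ys ++ q ∷ zs) →
            Attached G D a → Attached G D p → Attached G D q → ThreeAttachments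
    place {a} {s} {p} {q} xs [] zs lc atta attp attq =
      ⊥-elim (unattached-successor (rotate G (s ∷ xs) lc) attp attq)
    -- Here `q` ends the list, so its successor is the first vertex `a`.
    place {a} {s} {p} {q} xs (t ∷ ys) [] lc atta attp attq =
      ⊥-elim (unattached-successor (rotate G (s ∷ xs ++ p ∷ t ∷ ys)
        (subst (λ l → LongestCycleOn G K (a ∷ s ∷ l)) (sym (++-assoc xs (p ∷ t ∷ ys) (q ∷ []))) lc)) attq atta)
    place xs (t ∷ ys) (u ∷ zs) lc atta attp attq =
      _ , _ , _ , _ , _ , _ , xs , ys , zs , lc , atta , attp , attq

    arrange : ∀ {a s rest a₂ a₃} → LongestCycleOn G K (a ∷ s ∷ rest) → Attached G D a →
              Attached G D a₂ → Attached G D a₃ → a₂ ∈ rest → a₃ ∈ rest → a₃ ≢ a₂ → ThreeAttachments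
    arrange {a₃ = a₃} lc att att₂ att₃ m₂ m₃ a₃≢a₂ with ∈-∃++ m₂
    ... | us , ws , refl with ∈-++⁻ us m₃
    ...   | inj₂ (here eq) = contradiction eq a₃≢a₂
    ...   | inj₂ (there m) with ∈-∃++ m
    ...     | ys , zs , refl = place us ys zs lc att att₂ att₃
    arrange {a} {s} {a₂ = a₂} {a₃} lc att att₂ att₃ m₂ m₃ a₃≢a₂ | us , ws , refl | inj₁ m with ∈-∃++ m
    ...     | xs , ys , refl = place xs ys ws
              (subst (λ l → LongestCycleOn G K (a ∷ s ∷ l)) (++-assoc xs (a₃ ∷ ys) (a₂ ∷ ws)) lc) att att₃ att₂

    three-attachments : ThreeAttachments
    three-attachments with some-attachment D-closed Dy Ky (λ _ → K∌D) cycle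
    ... | a₁ , Ka₁ , att₁ with rotate-to G cycle Ka₁
    ...   | [] , lc with s≤s () ← length≥3 lc
    three-attachments | a₁ , Ka₁ , att₁ | s₁ ∷ rest , lc with unique lc
    ...   | (a₁≢s₁ ∷ _) ∷ _
      with attachment-avoiding D-closed Dy Ky Ka₁ Ka₁ (sound lc (there (here refl)))
             (K∌D (sound lc (there (here refl)))) (a₁≢s₁ ∘ sym) (a₁≢s₁ ∘ sym)
    ...     | a₂ , Ka₂ , a₂≢a₁ , _ , att₂
      -- The path ends at `s₁`, which differs from `a₂` because `a₂` is attached and the successor
      -- of `a₁` is not.
      with attachment-avoiding D-closed Dy Ky Ka₁ Ka₂ (sound lc (there (here refl)))
             (K∌D (sound lc (there (here refl)))) (a₁≢s₁ ∘ sym)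
             (λ { refl → unattached-successor lc att₁ att₂ })
    ...       | a₃ , Ka₃ , a₃≢a₁ , a₃≢a₂ , att₃ =
      arrange lc att₁ att₂ att₃ (later a₂≢a₁ att₂ (complete lc Ka₂)) (later a₃≢a₁ att₃ (complete lc Ka₃)) a₃≢a₂
      where
      later : ∀ {x} → x ≢ a₁ → Attached G D x → x ∈ a₁ ∷ s₁ ∷ rest → x ∈ rest
      later x≢a₁ att (here refl)         = contradiction refl x≢a₁
      later x≢a₁ att (there (here refl)) = ⊥-elim (unattached-successor lc att₁ att)
      later x≢a₁ att (there (there m))   = m

    -- Together, `nonadjacent` and `separated` exclude every path from `s` to `t` whose inner
    -- vertices avoid both `K` and `D`.
    record Unlinked (s t : Fin n) : Set where
      field
        distinct    : s ≢ t
        nonadjacent : ¬ Edge G s t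
        separated   : ∀ {z z′} → Edge G s z → Edge G t z′ → ¬ PathIn G (∁ K ∩ ∁ D) z z′
    open Unlinked

    unlinked-sym : ∀ {s t} → Unlinked s t → Unlinked t s
    unlinked-sym u = record
      { distinct    = distinct u ∘ sym
      ; nonadjacent = nonadjacent u ∘ adj-sym {G = G}
      ; separated   = λ e e′ p → separated u e′ e (path-sym p)
      }

    successors-unlinked : ∀ {a s b t} xs {ys} → LongestCycleOn G K (a ∷ s ∷ xs ++ b ∷ t ∷ ys) →
                          Attached G D a → Attached G D b → Unlinked s t
    successors-unlinked {s = s} {b} {t} xs {ys} lc atta attb = record
      { distinct    = s≢t
      ; nonadjacent = no-crossing G D-connected D∌K xs [] lc atta attb [] []
      ; separated   = λ e e′ p → let Q , q = simplify G p in
          no-crossing G D-connected D∌K xs Q lc atta attb (simple-unique G q)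
            (All.map (λ m → not-true (proj₁ (∧-elim m)) , not-true (proj₂ (∧-elim {not (K _)} m))) (simple-all G q))
            (simple-walk G e q (adj-sym {G = G} e′))
      }
      where
      s≢t : s ≢ t
      s≢t with unique lc
      ... | _ ∷ s∉ ∷ _ = All.lookup s∉ (∈-++⁺ʳ xs (there (here refl)))

    -- The 3 is 4 - 1: four deleted edges, and one fewer edge than vertices in a spanning tree of
    -- the rest.
    edge-rich : size X + 3 ≤ edgesIn G X
    edge-rich with three-attachments
    ... | a₁ , s₁ , a₂ , s₂ , a₃ , s₃ , xs , ys , zs , lc₁ , att₁ , att₂ , att₃ = begin
      size X + 3                  ≤⟨ +-monoˡ-≤ 3 (spanning-edges H₃ X s₁ (K⊆X s₁ Ks₁) reach) ⟩
      suc (edgesIn H₃ X) + 3      ≡⟨ +-comm (suc (edgesIn H₃ X)) 3 ⟩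
      4 + edgesIn H₃ X            ≡⟨ count-deleted ⟨
      edgesIn G X                 ∎
      where
      open ≤-Reasoning

      base : List (Fin n)
      base = xs ++ a₂ ∷ s₂ ∷ ys ++ a₃ ∷ s₃ ∷ zs

      eq₂ : (s₂ ∷ ys ++ a₃ ∷ s₃ ∷ zs) ++ a₁ ∷ s₁ ∷ xs ≡ s₂ ∷ ys ++ a₃ ∷ s₃ ∷ zs ++ a₁ ∷ s₁ ∷ xs
      eq₂ = ++-assoc (s₂ ∷ ys) (a₃ ∷ s₃ ∷ zs) (a₁ ∷ s₁ ∷ xs)

      eq₃ : (s₁ ∷ xs ++ a₂ ∷ s₂ ∷ ys) ++ a₃ ∷ s₃ ∷ zs ≡ s₁ ∷ base
      eq₃ = ++-assoc (s₁ ∷ xs) (a₂ ∷ s₂ ∷ ys) (a₃ ∷ s₃ ∷ zs)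

      lc₂ : LongestCycleOn G K (a₂ ∷ s₂ ∷ ys ++ a₃ ∷ s₃ ∷ zs ++ a₁ ∷ s₁ ∷ xs)
      lc₂ = subst (λ l → LongestCycleOn G K (a₂ ∷ l)) eq₂ (rotate G (s₁ ∷ xs) lc₁)

      lc₃ : LongestCycleOn G K (a₃ ∷ s₃ ∷ zs ++ a₁ ∷ s₁ ∷ xs ++ a₂ ∷ s₂ ∷ ys)
      lc₃ = rotate G (s₁ ∷ xs ++ a₂ ∷ s₂ ∷ ys) (subst (λ l → LongestCycleOn G K (a₁ ∷ l)) (sym eq₃) lc₁)

      s : Fin 3 → Fin n
      s = triple s₁ s₂ s₃

      u₁₂ : Unlinked s₁ s₂
      u₁₂ = successors-unlinked xs lc₁ att₁ att₂
      u₂₃ : Unlinked s₂ s₃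
      u₂₃ = successors-unlinked ys lc₂ att₂ att₃
      u₃₁ : Unlinked s₃ s₁
      u₃₁ = successors-unlinked zs lc₃ att₃ att₁

      unlinked : ∀ i j → i ≢ j → Unlinked (s i) (s j)
      unlinked 0F 0F i≢j = contradiction refl i≢j
      unlinked 0F 1F _   = u₁₂
      unlinked 0F 2F _   = unlinked-sym u₃₁
      unlinked 1F 0F _   = unlinked-sym u₁₂
      unlinked 1F 1F i≢j = contradiction refl i≢j
      unlinked 1F 2F _   = u₂₃
      unlinked 2F 0F _   = u₃₁
      unlinked 2F 1F _   = unlinked-sym u₂₃
      unlinked 2F 2F i≢j = contradiction refl i≢j

      -- All three walks are rotated to start at `a₁`, so that their conditions can be merged along
      -- one list.
      chords : ∀ i → ∃ λ z → Edge G (s i) z × Walk (OffEdge (s i) z) a₁ (s₁ ∷ base) a₁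
      chords 0F = chord Ky lc₁
      chords 1F with chord Ky lc₂
      ... | z , e , w = z , e , walk-rotate (s₂ ∷ ys ++ a₃ ∷ s₃ ∷ zs)
              (subst (λ l → Walk (OffEdge s₂ z) a₂ l a₂) (sym eq₂) w)
      chords 2F with chord Ky lc₃
      ... | z , e , w = z , e , subst (λ l → Walk (OffEdge s₃ z) a₁ l a₁) eq₃ (walk-rotate (s₃ ∷ zs) w)

      z : Fin 3 → Fin n
      z i = proj₁ (chords i)

      s-z : ∀ i → Edge G (s i) (z i)
      s-z i = proj₁ (proj₂ (chords i))

      Ka₁ : K a₁ ≡ true
      Ka₁ = sound lc₁ (here refl)

      Ks₁ : K s₁ ≡ true
      Ks₁ = sound lc₁ (there (here refl))

      Ks : ∀ i → K (s i) ≡ true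
      Ks = triple-elim Ks₁ (sound lc₂ (there (here refl))) (sound lc₃ (there (here refl)))

      s-unattached : ∀ i → ¬ Attached G D (s i)
      s-unattached = triple-elim (unattached-successor lc₁ att₁) (unattached-successor lc₂ att₂)
                                 (unattached-successor lc₃ att₃)

      -- This keeps the chords inside `X`, where the deleted edges have to be counted.
      Dz : ∀ i → D (z i) ≡ false
      Dz i = ¬-not λ d → s-unattached i (z i , d , s-z i)

      ∁D⊆X : ∀ {x} → D x ≡ false → X x ≡ true
      ∁D⊆X {x} Dx with X x in Xx
      ... | true  = refl
      ... | false = ⊥-elim (true≢false (∁X⊆D x Xx) Dx)

      H₀ H₁ H₂ H₃ : Graph n
      H₀ = delete G a₁ s₁
      H₁ = delete H₀ (s 0F) (z 0F)
      H₂ = delete H₁ (s 1F) (z 1F)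
      H₃ = delete H₂ (s 2F) (z 2F)

      kept : ∀ {x y} → Edge G x y → OffEdge a₁ s₁ x y → (∀ i → OffEdge (s i) (z i) x y) → Edge H₃ x y
      kept e off₀ off = delete-keeps H₂ (delete-keeps H₁ (delete-keeps H₀ (delete-keeps G e off₀) (off 0F)) (off 1F)) (off 2F)

      off₀ : ∀ i → OffEdge a₁ s₁ (s i) (z i)
      off₀ i = offEdge-sym (proj₁ (proj₂ (proj₂ (chords i))))

      -- The chords are different edges: a common one would force `s i` and `s j` to be equal or
      -- adjacent.
      off : ∀ i j → i ≢ j → OffEdge (s i) (z i) (s j) (z j)
      off i j i≢j = (λ (p , _) → distinct (unlinked i j i≢j) (sym p))
                  , (λ (p , _) → nonadjacent (unlinked i j i≢j) (subst (Edge G (s i)) (sym p) (s-z i)))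

      Xs : ∀ i → X (s i) ≡ true
      Xs i = K⊆X (s i) (Ks i)

      Xz : ∀ i → X (z i) ≡ true
      Xz i = ∁D⊆X (Dz i)

      count-deleted : edgesIn G X ≡ 4 + edgesIn H₃ X
      count-deleted =
        trans (edgesIn-delete G X (proj₁ (lc-walk G lc₁)) (K⊆X a₁ Ka₁) (K⊆X s₁ Ks₁)) (cong suc
        (trans (edgesIn-delete H₀ X e₀ (Xs 0F) (Xz 0F)) (cong suc
        (trans (edgesIn-delete H₁ X e₁ (Xs 1F) (Xz 1F)) (cong suc
        (edgesIn-delete H₂ X e₂ (Xs 2F) (Xz 2F)))))))
        where
        e₀ : Edge H₀ (s 0F) (z 0F)
        e₀ = delete-keeps G (s-z 0F) (off₀ 0F)
        e₁ : Edge H₁ (s 1F) (z 1F)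
        e₁ = delete-keeps H₀ (delete-keeps G (s-z 1F) (off₀ 1F)) (off 0F 1F λ ())
        e₂ : Edge H₂ (s 2F) (z 2F)
        e₂ = delete-keeps H₁ (delete-keeps H₀ (delete-keeps G (s-z 2F) (off₀ 2F)) (off 0F 2F λ ())) (off 1F 2F λ ())

      -- Without its first edge the cycle survives all deletions as a path from `s₁` to `a₁`.
      cycle-walk : Walk (Edge H₃) s₁ base a₁
      cycle-walk = walk-zip (λ { (e , o) f → kept e o f }) base
        (walk-zip _,_ base (proj₂ (lc-walk G lc₁)) avoids-first)
        (walk-zip (λ { (p , q) r → triple-elim p q r }) base
          (walk-zip _,_ base (proj₂ (proj₂ (proj₂ (chords 0F)))) (proj₂ (proj₂ (proj₂ (chords 1F)))))
          (proj₂ (proj₂ (proj₂ (chords 2F)))))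
        where
        go : ∀ l → LongestCycleOn G K (a₁ ∷ s₁ ∷ l) → Walk (OffEdge a₁ s₁) s₁ l a₁
        go [] lc with s≤s (s≤s ()) ← length≥3 lc
        go (t ∷ l) lc with unique lc
        ... | (a≢s ∷ a≢t ∷ _) ∷ (s≢t ∷ s∉) ∷ _ =
          ((λ (p , _) → a≢s (sym p)) , (λ (_ , q) → a≢t (sym q)))
          , walk-all {P = λ x → x ≢ s₁} (λ x≢s y≢s → (λ (_ , q) → y≢s q) , (λ (p , _) → x≢s p))
                     l (s≢t ∘ sym) (All.map (λ p → p ∘ sym) s∉) a≢s
        avoids-first : Walk (OffEdge a₁ s₁) s₁ base a₁
        avoids-first = go base lc₁

      reach-cycle : ∀ {x} → K x ≡ true → PathIn H₃ X s₁ x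
      reach-cycle Kx with complete lc₁ Kx
      ... | there m = walk-connects H₃ base cycle-walk (K⊆X s₁ Ks₁) on m
        where
        on : All (λ x → X x ≡ true) base
        on = All.tabulate λ m → K⊆X _ (sound lc₁ (there (there m)))
      ... | here refl = walk-path H₃ base cycle-walk (K⊆X s₁ Ks₁) on (K⊆X a₁ Ka₁)
        where
        on : All (λ x → X x ≡ true) base
        on = All.tabulate λ m → K⊆X _ (sound lc₁ (there (there m)))

      -- Every deleted edge has an end on the cycle. Hence nothing is lost among the vertices off
      -- it, and only the edge by which the path enters the cycle has to be checked.
      to-cycle : ∀ {x w c} → PathIn G (X ∩ ∁ K) x w → Edge G w c → K c ≡ true →
                 (∀ i → ¬ (w ≡ z i × c ≡ s i)) → PathIn H₃ X s₁ x
      to-cycle {w = w} {c} p e Kc off-chord =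
        path-trans (reach-cycle Kc) (path-sym (path-trans
          (path-mono (λ _ m → proj₁ (∧-elim m)) (path-transfer inner p))
          (step (proj₁ (∧-elim (path-target p))) last (here (K⊆X c Kc)))))
        where
        out : ∀ {x} → (X ∩ ∁ K) x ≡ true → K x ≡ false
        out {x} m = not-true (proj₂ (∧-elim {X x} m))
        inner : ∀ x y → (X ∩ ∁ K) x ≡ true → (X ∩ ∁ K) y ≡ true → Edge G x y → Edge H₃ x y
        inner x y mx my e = kept e
          ((λ (p , _) → outside≢ (out mx) Ka₁ p) , (λ (_ , q) → outside≢ (out my) Ka₁ q))
          λ i → (λ (p , _) → outside≢ (out mx) (Ks i) p) , (λ (_ , q) → outside≢ (out my) (Ks i) q)
        Kw : K w ≡ false
        Kw = out (path-target p)
        last : Edge H₃ w c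
        last = kept e ((λ (p , _) → outside≢ Kw Ka₁ p) , (λ (p , _) → outside≢ Kw Ks₁ p))
          λ i → (λ (p , _) → outside≢ Kw (Ks i) p) , off-chord i

      ∁D-closed : Closed {G = G} (∁ K) (∁ K ∩ ∁ D)
      ∁D-closed p q m Kq e = ∧-intro Kq (not-false (¬-not λ Dq →
        true≢false (D-closed q p Dq (proj₁ (∧-elim {not (K p)} m)) (adj-sym {G = G} e))
                   (not-true (proj₂ (∧-elim {not (K p)} m)))))

      leave-outside : ∀ {U x} → D x ≡ false → K x ≡ false → ∀ {v} → K v ≡ true → PathIn G U x v →
                      ∃₂ λ w c → PathIn G (∁ K ∩ ∁ D) x w × Edge G w c × U c ≡ true × K c ≡ true
      leave-outside {U} Dx Kx Kv p with path-first-hit K Kx Kv p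
      ... | w , c , q , e , Uc , Kc =
        w , c , path-in-closed ∁D-closed (∧-intro (not-false Kx) (not-false Dx))
                  (path-mono (λ x m → proj₂ (∧-elim {U x} m)) q) , e , Uc , Kc

      in-X : (∁ K ∩ ∁ D) ⊆ (X ∩ ∁ K)
      in-X x m with ∧-elim {not (K x)} m
      ... | k , d = ∧-intro (∁D⊆X (not-true d)) k

      chord? : ∀ w c → Dec (∃ λ i → w ≡ z i × c ≡ s i)
      chord? w c = any? λ i → (w ≟ z i) ×-dec (c ≟ s i)

      reach : ∀ x → X x ≡ true → PathIn H₃ X s₁ x
      reach x Xx with K x in Kx | D x in Dx
      ... | true  | _    = reach-cycle Kx
      -- The path stays in `D` until it meets the cycle, whereas no `z i` lies in `D`; so it does
      -- not enter along a chord.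
      ... | false | true with path-first-hit K Kx Ks₁ (X-connected x s₁ Xx (K⊆X s₁ Ks₁))
      ...   | w , c , p , e , _ , Kc = to-cycle p e Kc λ i (w≡z , _) →
        true≢false (path-target (path-in-closed D-closed Dx (path-mono (λ x m → proj₂ (∧-elim {X x} m)) p)))
                   (trans (cong D w≡z) (Dz i))
      -- Vertices outside `D` belong to `X` automatically, so paths of the whole graph may be used.
      reach x Xx | false | false with leave-outside Dx Kx Ks₁ (connected x s₁)
      ... | w , c , p , e , _ , Kc with chord? w c
      ...   | no  none = to-cycle (path-mono in-X p) e Kc λ i eq → none (i , eq)
      -- The component of x meets a chord at s i; by 3-connectedness it reaches the cycle elsewhere,
      -- and that edge is not a chord because s i is unlinked from the other successors.
      ...   | yes (i , refl , refl)
        with leave-outside Dx Kx Ka₁ (reroute (s i) (s i) (outside≢ Kx (Ks i)) (outside≢ Kx (Ks i)) a₁≢s a₁≢s)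
        where
        a₁≢s : a₁ ≢ s i
        a₁≢s eq = s-unattached i (subst (Attached G D) eq att₁)
      ...     | w′ , c′ , p′ , e′ , c′∉ , Kc′ = to-cycle (path-mono in-X p′) e′ Kc′ off-chord
        where
        off-chord : ∀ j → ¬ (w′ ≡ z j × c′ ≡ s j)
        off-chord j (refl , refl) = separated (unlinked i j i≢j) (s-z i) (s-z j) (path-trans (path-sym p) p′)
          where
          i≢j : i ≢ j
          i≢j refl = proj₁ (∉pair⁻ (s i) (s i) (not-true c′∉)) refl

  -- The edges outside the bond number at least (|Y| - 1) + (|∁ Y| + 3) = n + 2.
  large-bond-meets : ∀ {K Y vs} → LongestCycleOn G K vs → IsBondSide G Y → (∀ x → K x ≡ true → Y x ≡ false) →
                     ¬ (numEdges G ≤ bondSize G Y + n + 1)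
  large-bond-meets {K} {Y} lc ((y , Yy) , _ , Y-connected , X-connected) K∌Y few
    with component G (∁ K) y (not-false (Ky))
    where
    Ky : K y ≡ false
    Ky = ¬-not λ k → true≢false Yy (K∌Y y k)
  ... | D , Dy , D⊆∁K , D-closed , D-connected = <⇒≱ many few
    where
    Y⊆∁K : Y ⊆ ∁ K
    Y⊆∁K x Yx = not-false (¬-not λ k → true≢false Yx (K∌Y x k))
    rich : size (∁ Y) + 3 ≤ edgesIn G (∁ Y)
    rich = CycleInSide.edge-rich lc (λ x k → not-false (K∌Y x k)) X-connected
      (λ x m → path-target (path-in-closed D-closed Dy (path-mono Y⊆∁K (Y-connected y x Yy (not-injective m)))))
      Dy D⊆∁K D-closed D-connected
    many : bondSize G Y + n + 1 < numEdges G
    many = ≤-pred (begin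
      suc (suc (bondSize G Y + n + 1))          ≡⟨ cong (λ k → suc (suc k)) (+-assoc (bondSize G Y) n 1) ⟩
      2 + (bondSize G Y + (n + 1))              ≡⟨ +-comm 2 _ ⟩
      bondSize G Y + (n + 1) + 2                ≡⟨ +-assoc (bondSize G Y) (n + 1) 2 ⟩
      bondSize G Y + (n + 1 + 2)                ≡⟨ cong (bondSize G Y +_) (+-assoc n 1 2) ⟩
      bondSize G Y + (n + 3)                    ≡⟨ cong (λ k → bondSize G Y + (k + 3)) (size-∁ Y) ⟨
      bondSize G Y + (size Y + size (∁ Y) + 3)  ≡⟨ cong (bondSize G Y +_) (+-assoc (size Y) _ 3) ⟩
      bondSize G Y + (size Y + (size (∁ Y) + 3))
        ≤⟨ +-monoʳ-≤ (bondSize G Y) (+-mono-≤ (spanning-edges G Y y Yy λ x Yx → Y-connected y x Yy Yx) rich) ⟩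
      bondSize G Y + suc (edgesIn G Y + edgesIn G (∁ Y)) ≡⟨ +-suc (bondSize G Y) _ ⟩
      suc (bondSize G Y + (edgesIn G Y + edgesIn G (∁ Y))) ≡⟨ cong suc (numEdges-partition G Y) ⟨
      suc (numEdges G)                          ∎)
      where open ≤-Reasoning

-- A cycle with few vertices outside it

-- On a cycle this finds the predecessor of the starting vertex, its second cycle neighbour.
walk-last : ∀ {A : Set} {R : A → A → Set} {u v} xs → Walk R u xs v → ∃ λ l → l ∈ u ∷ xs × R l v
walk-last []       p = _ , here refl , p
walk-last (x ∷ xs) (_ , p) with walk-last xs p
... | l , m , r = l , there m , r

module _ {n : ℕ} (G : Graph n) where

  attached-mono : ∀ {D D′ a} → D ⊆ D′ → Attached G D a → Attached G D′ a
  attached-mono s (d , Dd , e) = d , s d Dd , e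

  connected-∪ : ∀ {Y v} → ConnectedOn G Y → Attached G Y v → ConnectedOn G (Y ∪⁅ v ⁆)
  connected-∪ {Y} {v} conn (y , Yy , e) = connected-from y path
    where
    up : Y ⊆ (Y ∪⁅ v ⁆)
    up x = ∪⁺ˡ {U = Y} v
    path : ∀ x → (Y ∪⁅ v ⁆) x ≡ true → PathIn G (Y ∪⁅ v ⁆) y x
    path x m with ∪⁻ Y v m
    ... | inj₁ Yx   = path-mono up (conn y x Yy Yx)
    ... | inj₂ refl = step (up y Yy) (adj-sym {G = G} e) (here (∪⁺ʳ Y v))

  -- At most one edge of `v`, the one to `u`, leaves the cut, while those to `x₁` and `x₂` enter it.
  bond-gain : ∀ {Y v u x₁ x₂} → Y v ≡ false → (∀ x → Y x ≡ true → Edge G v x → x ≡ u) →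
              Edge G v x₁ → Edge G v x₂ → Y x₁ ≡ false → Y x₂ ≡ false → x₁ ≢ x₂ →
              bondSize G Y < bondSize G (Y ∪⁅ v ⁆)
  bond-gain {Y} {v} {u} Yv only e₁ e₂ Y₁ Y₂ x₁≢x₂ = +-cancelʳ-≤ 1 _ _ (begin
    suc (bondSize G Y) + 1                   ≡⟨ +-suc (bondSize G Y) 1 ⟨
    bondSize G Y + 2                         ≤⟨ +-monoʳ-≤ (bondSize G Y) outdegree ⟩
    bondSize G Y + degreeIn G (∁ Y) v        ≡⟨ bondSize-∪ G Y v Yv ⟨
    bondSize G (Y ∪⁅ v ⁆) + degreeIn G Y v   ≤⟨ +-monoʳ-≤ (bondSize G (Y ∪⁅ v ⁆)) indegree ⟩
    bondSize G (Y ∪⁅ v ⁆) + 1                ∎)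
    where
    open ≤-Reasoning
    outdegree : 2 ≤ degreeIn G (∁ Y) v
    outdegree = two≤size (adj G v ∩ ∁ Y) (∧-intro e₁ (not-false Y₁)) (∧-intro e₂ (not-false Y₂)) x₁≢x₂
    indegree : degreeIn G Y v ≤ 1
    indegree = size≤length (adj G v ∩ Y) (u ∷ []) λ x m →
      here (only x (proj₂ (∧-elim {adj G v x} m)) (proj₁ (∧-elim m)))

  degreeIn≤size : ∀ U v → degreeIn G U v ≤ size U
  degreeIn≤size U v = size-mono λ x m → proj₂ (∧-elim {adj G v x} m)

  module _ (3-connected : KConnected 3 G) {K : VSet n} where

    module _ {Y : VSet n} (largest : IsLargestBond G Y) (K∌Y : ∀ x → K x ≡ true → Y x ≡ false) where

      y : Fin n
      y = proj₁ (proj₁ (proj₁ largest))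

      Yy : Y y ≡ true
      Yy = proj₂ (proj₁ (proj₁ largest))

      Y-connected : ConnectedOn G Y
      Y-connected = proj₁ (proj₂ (proj₂ (proj₁ largest)))

      ∁Y-connected : ConnectedOn G (∁ Y)
      ∁Y-connected = proj₂ (proj₂ (proj₂ (proj₁ largest)))

      Y∌K : ∀ x → Y x ≡ true → K x ≡ false
      Y∌K x Yx = ¬-not λ Kx → true≢false Yx (K∌Y x Kx)

      Ky : K y ≡ false
      Ky = Y∌K y Yy

      no-larger : ∀ {Z v} → Y ⊆ Z → Z v ≡ false → ConnectedOn G Z → ConnectedOn G (∁ Z) →
                  bondSize G Z ≤ bondSize G Y
      no-larger {Z} Y⊆Z Zv c c′ = proj₂ largest Z ((y , Y⊆Z y Yy) , (_ , Zv) , c , c′)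

      -- Only the connectedness of what remains depends on where the other vertices off the cycle
      -- lie, so each case supplies it as `rest-connected`.
      module TwoMoves {a b c rest} (lc : LongestCycleOn G K (a ∷ b ∷ c ∷ rest))
        (atta : Attached G Y a) (¬attb : ¬ Attached G Y b)
        (rest-connected : ConnectedOn G (∁ (Y ∪⁅ a ⁆ ∪⁅ b ⁆))) where

        Ya : Y a ≡ false
        Ya = K∌Y a (sound lc (here refl))
        Yb : Y b ≡ false
        Yb = K∌Y b (sound lc (there (here refl)))
        Yc : Y c ≡ false
        Yc = K∌Y c (sound lc (there (there (here refl))))

        a≢b : a ≢ b
        a≢b with unique lc
        ... | (p ∷ _) ∷ _ = p
        a≢c : a ≢ c
        a≢c with unique lc
        ... | (_ ∷ p ∷ _) ∷ _ = p
        b≢ : ∀ {x} → x ∈ c ∷ rest → b ≢ x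
        b≢ m with unique lc
        ... | _ ∷ p ∷ _ = All.lookup p m
        b≢c : b ≢ c
        b≢c = b≢ (here refl)

        Y₁ Y₂ : VSet n
        Y₁ = Y ∪⁅ a ⁆
        Y₂ = Y₁ ∪⁅ b ⁆

        Y⊆Y₂ : Y ⊆ Y₂
        Y⊆Y₂ x m = ∪⁺ˡ {U = Y₁} b (∪⁺ˡ {U = Y} a m)

        edge-ab : Edge G a b
        edge-ab = proj₁ (lc-walk G lc)
        edge-bc : Edge G b c
        edge-bc = proj₁ (proj₂ (lc-walk G lc))

        Y₂-connected : ConnectedOn G Y₂
        Y₂-connected = connected-∪ (connected-∪ Y-connected atta) (a , ∪⁺ʳ Y a , adj-sym {G = G} edge-ab)

        -- Being unattached, `b` has only `a` in `Y₁`, while `c` and a third neighbour lie outside.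
        gain : bondSize G Y₁ < bondSize G Y₂
        gain with neighbour-avoiding G 3-connected {b} {a} {c} {y} (a≢b ∘ sym) b≢c
                    (outside≢ G 3-connected Ky (sound lc (there (here refl))))
                    (outside≢ G 3-connected Ky (sound lc (here refl)))
                    (outside≢ G 3-connected Ky (sound lc (there (there (here refl)))))
        ... | z , e , z≢a , z≢c =
          bond-gain {u = a} (∪∁⁺ Y a Yb (a≢b ∘ sym)) only edge-bc e
            (∪∁⁺ Y a Yc (a≢c ∘ sym)) (∪∁⁺ Y a (¬-not λ Yz → ¬attb (z , Yz , e)) z≢a) (z≢c ∘ sym)
          where
          only : ∀ x → Y₁ x ≡ true → Edge G b x → x ≡ a
          only x m e with ∪⁻ Y a m
          ... | inj₁ Yx = ⊥-elim (¬attb (x , Yx , e))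
          ... | inj₂ eq = eq

        loss : bondSize G Y₁ < bondSize G Y
        loss = ≤-trans gain (no-larger Y⊆Y₂ (∪∁⁺ Y₁ b (∪∁⁺ Y a Yc (a≢c ∘ sym)) (b≢c ∘ sym)) Y₂-connected rest-connected)

        outdegree<indegree : degreeIn G (∁ Y) a < degreeIn G Y a
        outdegree<indegree = +-cancelˡ-< (bondSize G Y₁) _ _ (begin-strict
          bondSize G Y₁ + degreeIn G (∁ Y) a  <⟨ +-monoˡ-< (degreeIn G (∁ Y) a) loss ⟩
          bondSize G Y + degreeIn G (∁ Y) a   ≡⟨ bondSize-∪ G Y a Ya ⟨
          bondSize G Y₁ + degreeIn G Y a      ∎)
          where open ≤-Reasoning

        outdegree≥2 : 2 ≤ degreeIn G (∁ Y) a
        outdegree≥2 with walk-last rest (proj₂ (proj₂ (lc-walk G lc)))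
        ... | l , m , e = two≤size (adj G a ∩ ∁ Y) (∧-intro edge-ab (not-false Yb))
                            (∧-intro (adj-sym {G = G} e) (not-false (K∌Y l (sound lc (there (there m)))))) (b≢ m)

        indegree≥3 : 3 ≤ degreeIn G Y a
        indegree≥3 = ≤-trans (s≤s outdegree≥2) outdegree<indegree

      list-connected : ∀ {u xs v Z} → Walk (Edge G) u xs v → All (λ x → Z x ≡ true) (u ∷ xs) →
                       (∀ x → Z x ≡ true → x ∈ u ∷ xs) → ConnectedOn G Z
      list-connected {u} {xs} w (Zu ∷ Zxs) sub = connected-from u λ x Zx → walk-connects G xs w Zu Zxs (sub x Zx)

      -- Here the far side is exactly the cycle. With |Y| ≤ 3, the three neighbours of `a` in `Y`
      -- are all of `Y`, which is what makes a third move possible.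
      spanning-cycle : ∀ {vs} → LongestCycleOn G K vs → (∀ x → Y x ≡ false → K x ≡ true) → size Y ≤ 3 → ⊥
      spanning-cycle lc₀ spans small = start
        where
        closed : Closed {G = G} (∁ K) Y
        closed p q _ Kq _ = ¬-not λ Yq → true≢false (spans q Yq) (not-true Kq)

        unattached-successor : ∀ {a b rest} → LongestCycleOn G K (a ∷ b ∷ rest) → Attached G Y a → ¬ Attached G Y b
        unattached-successor = no-consecutive G Y-connected Y∌K

        -- Any two vertices of a triangle are consecutive, so a second attachment is impossible.
        triangle : ∀ {a b c} → LongestCycleOn G K (a ∷ b ∷ c ∷ []) → Attached G Y a → ⊥
        triangle {a} {b} {c} lc atta with unique lc
        ... | (a≢b ∷ _) ∷ _
          with attachment-avoiding G 3-connected closed Yy Ky (sound lc (here refl)) (sound lc (here refl))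
                 (sound lc (there (here refl))) (K∌Y b (sound lc (there (here refl)))) (a≢b ∘ sym) (a≢b ∘ sym)
        ...   | d , Kd , d≢a , _ , attd with complete lc Kd
        ...     | here d≡a                   = d≢a d≡a
        ...     | there (here refl)          = unattached-successor lc atta attd
        ...     | there (there (here refl)) = unattached-successor (rotate G (b ∷ []) lc) attd atta

        long : ∀ {a b c r rs} → LongestCycleOn G K (a ∷ b ∷ c ∷ r ∷ rs) → Attached G Y a → ⊥
        long {a} {b} {c} {r} {rs} lc atta with unique lc
        ... | (_ ∷ _ ∷ a≢r ∷ a∉) ∷ (_ ∷ b≢r ∷ b∉) ∷ (c≢r ∷ c∉) ∷ _ = <⇒≱ (n<1+n _) too-large
          where
          tail-connected : ConnectedOn G (∁ (Y ∪⁅ a ⁆ ∪⁅ b ⁆))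
          tail-connected = list-connected (proj₂ (proj₂ (lc-walk G lc))) (All.tabulate inside) covered
            where
            covered : ∀ x → ∁ (Y ∪⁅ a ⁆ ∪⁅ b ⁆) x ≡ true → x ∈ c ∷ r ∷ rs
            covered x m with ∪∁⁻ (Y ∪⁅ a ⁆) b (not-true m)
            ... | m′ , x≢b with ∪∁⁻ Y a m′
            ...   | Yx , x≢a with complete lc (spans x Yx)
            ...     | here eq           = contradiction eq x≢a
            ...     | there (here eq)   = contradiction eq x≢b
            ...     | there (there x∈) = x∈
            inside : ∀ {x} → x ∈ c ∷ r ∷ rs → ∁ (Y ∪⁅ a ⁆ ∪⁅ b ⁆) x ≡ true
            inside x∈ with unique lc
            ... | (_ ∷ a∉) ∷ b∉ ∷ _ = not-false (∪∁⁺ (Y ∪⁅ a ⁆) b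
                    (∪∁⁺ Y a (K∌Y _ (sound lc (there (there x∈)))) (All.lookup a∉ x∈ ∘ sym)) (All.lookup b∉ x∈ ∘ sym))

          open TwoMoves lc atta (unattached-successor lc atta) tail-connected

          complete-to-Y : ∀ x → Y x ≡ true → Edge G a x
          complete-to-Y x Yx with adj G a x in e
          ... | true  = refl
          ... | false = ⊥-elim (<⇒≱ (≤-trans (s≤s (size-mono sub)) (≤-trans (≤-reflexive (sym (size-∖ Y x Yx))) small)) indegree≥3)
            where
            sub : (adj G a ∩ Y) ⊆ (Y ∖⁅ x ⁆)
            sub z m = ∖⁺ Y x (proj₂ (∧-elim {adj G a z} m)) λ { refl → true≢false (proj₁ (∧-elim m)) e }

          another : ∀ d → ∃ λ x → Y x ≡ true × x ≢ d
          another d with any? (λ x → (Y x ≟ᵇ true) ×-dec ¬? (x ≟ d))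
          ... | yes found = found
          ... | no  none  = ⊥-elim (<⇒≱ (s≤s (s≤s z≤n)) (≤-trans indegree≥3 (≤-trans (degreeIn≤size Y a) one)))
            where
            one : size Y ≤ 1
            one = size≤length Y (d ∷ []) λ x Yx → case x ≟ d of λ where
              (yes eq)  → here eq
              (no  x≢d) → contradiction (x , Yx , x≢d) none

          -- A neighbour `d` of `c` in `Y` has itself a neighbour `w` in `Y`, and `w` is adjacent to
          -- `a`: the detour a, w, d, c bypasses `b`.
          ¬attc : ¬ Attached G Y c
          ¬attc (d , Yd , e) with another d
          ... | x , Yx , x≢d with path-neighbour (x≢d ∘ sym) (Y-connected d x Yd Yx)
          ...   | w , Yw , e′ = no-detour G lc (Y∌K w Yw) (Y∌K d Yd) (complete-to-Y w Yw) (adj-sym {G = G} e′) (adj-sym {G = G} e)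

          outdegree≤2 : degreeIn G (∁ Y) a ≤ 2
          outdegree≤2 = ≤-pred (≤-trans outdegree<indegree (≤-trans (degreeIn≤size Y a) small))

          -- The two cycle neighbours of `a` already exhaust its neighbours outside `Y`.
          ¬edge-ac : ¬ Edge G a c
          ¬edge-ac e with walk-last rs (proj₂ (proj₂ (proj₂ (lc-walk G lc))))
          ... | l , m , e′ = <⇒≱ (s≤s outdegree≤2) (length≤size (adj G a ∩ ∁ Y)
                  ((b≢c ∷ b≢ (there m) ∷ []) ∷ (All.lookup (c≢r ∷ c∉) m ∷ []) ∷ [] ∷ [])
                  (∧-intro edge-ab (not-false Yb) ∷ ∧-intro e (not-false Yc)
                   ∷ ∧-intro (adj-sym {G = G} e′) (not-false (K∌Y l (sound lc (there (there (there m)))))) ∷ []))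

          Y₃ : VSet n
          Y₃ = Y₂ ∪⁅ c ⁆

          outside₂ : ∀ {x} → Y x ≡ false → x ≢ a → x ≢ b → Y₂ x ≡ false
          outside₂ Yx x≢a x≢b = ∪∁⁺ Y₁ b (∪∁⁺ Y a Yx x≢a) x≢b

          Yr : Y r ≡ false
          Yr = K∌Y r (sound lc (there (there (there (here refl)))))

          -- As `c` is adjacent neither to `Y` nor to `a`, its only neighbour in `Y₂` is `b`.
          gain₃ : bondSize G Y₂ < bondSize G Y₃
          gain₃ with neighbour-avoiding G 3-connected {c} {b} {r} {y} (b≢c ∘ sym) c≢r
                       (outside≢ G 3-connected Ky (sound lc (there (there (here refl)))))
                       (outside≢ G 3-connected Ky (sound lc (there (here refl))))
                       (outside≢ G 3-connected Ky (sound lc (there (there (there (here refl))))))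
          ... | z , e , z≢b , z≢r =
            bond-gain {u = b} (outside₂ Yc (a≢c ∘ sym) (b≢c ∘ sym)) only (proj₁ (proj₂ (proj₂ (lc-walk G lc)))) e
              (outside₂ Yr (a≢r ∘ sym) (b≢r ∘ sym))
              (outside₂ (¬-not λ Yz → ¬attc (z , Yz , e)) (λ { refl → ¬edge-ac (adj-sym {G = G} e) }) z≢b)
              (z≢r ∘ sym)
            where
            only : ∀ x → Y₂ x ≡ true → Edge G c x → x ≡ b
            only x m e with ∪⁻ Y₁ b m
            ... | inj₂ eq = eq
            ... | inj₁ m′ with ∪⁻ Y a m′
            ...   | inj₁ Yx   = ⊥-elim (¬attc (x , Yx , e))
            ...   | inj₂ refl = ⊥-elim (¬edge-ac (adj-sym {G = G} e))

          tail₃-connected : ConnectedOn G (∁ Y₃)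
          tail₃-connected = list-connected (proj₂ (proj₂ (proj₂ (lc-walk G lc)))) (All.tabulate inside) covered
            where
            covered : ∀ x → ∁ Y₃ x ≡ true → x ∈ r ∷ rs
            covered x m with ∪∁⁻ Y₂ c (not-true m)
            ... | m₂ , x≢c with ∪∁⁻ Y₁ b m₂
            ...   | m₁ , x≢b with ∪∁⁻ Y a m₁
            ...     | Yx , x≢a with complete lc (spans x Yx)
            ...       | here eq                   = contradiction eq x≢a
            ...       | there (here eq)           = contradiction eq x≢b
            ...       | there (there (here eq))   = contradiction eq x≢c
            ...       | there (there (there x∈)) = x∈
            inside : ∀ {x} → x ∈ r ∷ rs → ∁ Y₃ x ≡ true
            inside x∈ = not-false (∪∁⁺ Y₂ c (outside₂ (K∌Y _ (sound lc (there (there (there x∈)))))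
              (All.lookup (a≢r ∷ a∉) x∈ ∘ sym) (All.lookup (b≢r ∷ b∉) x∈ ∘ sym)) (All.lookup (c≢r ∷ c∉) x∈ ∘ sym))

          bounded₃ : bondSize G Y₃ ≤ bondSize G Y
          bounded₃ = no-larger (λ x m → ∪⁺ˡ {U = Y₂} c (Y⊆Y₂ x m))
            (∪∁⁺ Y₂ c (outside₂ Yr (a≢r ∘ sym) (b≢r ∘ sym)) (c≢r ∘ sym))
            (connected-∪ Y₂-connected (b , ∪⁺ʳ Y₁ b , adj-sym {G = G} edge-bc)) tail₃-connected

          -- The bond of `Y` exceeds that of `Y₁` by at most 3 - 2 = 1, but two gains after `Y₁`
          -- force an excess of at least 2.
          too-large : suc (bondSize G Y₁ + 3) ≤ bondSize G Y₁ + 3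
          too-large = begin
            suc (bondSize G Y₁ + 3)             ≡⟨ +-suc (bondSize G Y₁) 3 ⟨
            bondSize G Y₁ + 4                   ≡⟨ +-assoc (bondSize G Y₁) 2 2 ⟨
            bondSize G Y₁ + 2 + 2               ≡⟨ cong (_+ 2) (+-comm (bondSize G Y₁) 2) ⟩
            suc (suc (bondSize G Y₁)) + 2       ≤⟨ +-mono-≤ (≤-trans (≤-trans (s≤s gain) gain₃) bounded₃) outdegree≥2 ⟩
            bondSize G Y + degreeIn G (∁ Y) a   ≡⟨ bondSize-∪ G Y a Ya ⟨
            bondSize G Y₁ + degreeIn G Y a      ≤⟨ +-monoʳ-≤ (bondSize G Y₁) (≤-trans (degreeIn≤size Y a) small) ⟩
            bondSize G Y₁ + 3                   ∎
            where open ≤-Reasoning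

        start : ⊥
        start with some-attachment G 3-connected closed Yy Ky K∌Y lc₀
        ... | a , Ka , atta with rotate-to G lc₀ Ka
        ...   | []              , lc with s≤s () ← length≥3 lc
        ...   | _ ∷ []          , lc with s≤s (s≤s ()) ← length≥3 lc
        ...   | b ∷ c ∷ []      , lc = triangle lc atta
        ...   | b ∷ c ∷ r ∷ rs , lc = long lc atta

      -- Moving a cycle neighbour `a` of `y` loses one edge and gains two. The far side is then the
      -- graph without `y` and `a`, connected by 3-connectedness.
      singleton-side : ∀ {vs} → LongestCycleOn G K vs → size (∁ K) ≤ 3 → size Y ≤ 1 → ⊥
      singleton-side {vs} lc₀ few one with neighbour
        where
        S : VSet n
        -- At most two vertices; once they are deleted, the first edge of a path from `y` can only
        -- lead onto the cycle.
        S = ∁ K ∖⁅ y ⁆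
        S-small : size S < 3
        S-small = ≤-trans (≤-reflexive (sym (size-∖ (∁ K) y (not-false Ky)))) few
        some-vertex : ∀ {vs} → LongestCycleOn G K vs → ∃ λ v → K v ≡ true
        some-vertex {[]} lc with () ← length≥3 lc
        some-vertex {v ∷ _} lc = v , sound lc (here refl)
        K⇒∁S : ∀ {x} → K x ≡ true → ∁ S x ≡ true
        K⇒∁S {x} Kx = not-false (¬-not λ m → true≢false Kx (not-true (proj₁ (∖⁻ (∁ K) y {x} m))))
        neighbour : ∃ λ a → K a ≡ true × Edge G y a
        neighbour with some-vertex lc₀
        ... | v , Kv with path-neighbour (outside≢ G 3-connected Ky Kv)
                           (proj₂ 3-connected S S-small y v
                             (not-false (¬-not λ m → proj₂ (∖⁻ (∁ K) y {y} m) refl)) (K⇒∁S Kv))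
        ...   | a , a∉ , e = a , ¬-not Ka , e
          where
          Ka : K a ≢ false
          Ka Ka = true≢false (∖⁺ (∁ K) y {a} (not-false Ka) (adj⇒≢ {G = G} e ∘ sym)) (not-true a∉)
      ... | a , Ka , e with rotate-to G lc₀ Ka
      ...   | []              , lc with s≤s () ← length≥3 lc
      ...   | _ ∷ []          , lc with s≤s (s≤s ()) ← length≥3 lc
      ...   | b ∷ c ∷ rest    , lc with walk-last rest (proj₂ (proj₂ (lc-walk G lc))) | unique lc
      ...     | l , m , e′ | (a≢b ∷ _) ∷ b∉ ∷ _ = <⇒≱ gain bounded
        where
        only-y : ∀ x → Y x ≡ true → x ≡ y
        only-y x Yx with x ≟ y
        ... | yes eq = eq
        ... | no x≢y = ⊥-elim (<⇒≱ (two≤size Y Yx Yy x≢y) one)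
        Yb : Y b ≡ false
        Yb = K∌Y b (sound lc (there (here refl)))
        gain : bondSize G Y < bondSize G (Y ∪⁅ a ⁆)
        gain = bond-gain {u = y} (K∌Y a Ka) (λ x Yx _ → only-y x Yx) (proj₁ (lc-walk G lc)) (adj-sym {G = G} e′)
                 Yb (K∌Y l (sound lc (there (there m)))) (All.lookup b∉ m)
        to : ∁ (pair G 3-connected y a) ⊆ ∁ (Y ∪⁅ a ⁆)
        to x m with ∉pair⁻ G 3-connected y a (not-true m)
        ... | x≢y , x≢a = not-false (∪∁⁺ Y a (¬-not λ Yx → x≢y (only-y x Yx)) x≢a)
        from : ∁ (Y ∪⁅ a ⁆) ⊆ ∁ (pair G 3-connected y a)
        from x m with ∪∁⁻ Y a (not-true m)
        ... | Yx , x≢a = not-false (∉pair G 3-connected y a (λ { refl → true≢false Yy Yx }) x≢a)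
        bounded : bondSize G (Y ∪⁅ a ⁆) ≤ bondSize G Y
        bounded = no-larger (λ x → ∪⁺ˡ {U = Y} a) (∪∁⁺ Y a Yb (a≢b ∘ sym))
          (connected-∪ Y-connected (y , Yy , adj-sym {G = G} e))
          (connected-cong to from (proj₂ 3-connected (pair G 3-connected y a) (pair-small G 3-connected y a)))

    -- One vertex `w` off the cycle shares its side. Since |Y| ≤ 2 excludes three neighbours in `Y`,
    -- it is enough to choose `a` so that `TwoMoves` applies.
    module OneExtraVertex {Y : VSet n} {w : Fin n} (largest : IsLargestBond G Y)
      (K∌Y : ∀ x → K x ≡ true → Y x ≡ false) (Yw : Y w ≡ false) (Kw : K w ≡ false)
      (only-w : ∀ x → Y x ≡ false → K x ≡ false → x ≡ w) (small : size Y ≤ 2) where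

      module _ {a b rest z} (lc : LongestCycleOn G K (a ∷ b ∷ rest)) (e : Edge G w z) (Kz : K z ≡ true)
        (z≢a : z ≢ a) (z≢b : z ≢ b) where

        -- After `a` and `b` have moved, the edge to `z` still ties `w` to the rest of the cycle.
        anchored : Attached G Y a → ¬ Attached G Y b → ⊥
        anchored = go lc
          where
          go : ∀ {rest} → LongestCycleOn G K (a ∷ b ∷ rest) → Attached G Y a → ¬ Attached G Y b → ⊥
          go {[]} lc with s≤s (s≤s ()) ← length≥3 lc
          go {c ∷ rest} lc atta ¬attb =
            <⇒≱ (s≤s small) (≤-trans (TwoMoves.indegree≥3 largest K∌Y lc atta ¬attb conn) (degreeIn≤size Y a))
            where
            Z : VSet n
            Z = ∁ (Y ∪⁅ a ⁆ ∪⁅ b ⁆)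
            Z⁺ : ∀ {x} → Y x ≡ false → x ≢ a → x ≢ b → Z x ≡ true
            Z⁺ Yx x≢a x≢b = not-false (∪∁⁺ (Y ∪⁅ a ⁆) b (∪∁⁺ Y a Yx x≢a) x≢b)
            Zw : Z w ≡ true
            Zw = Z⁺ Yw (outside≢ G 3-connected Kw (sound lc (here refl)))
                       (outside≢ G 3-connected Kw (sound lc (there (here refl))))
            inside : ∀ {x} → x ∈ c ∷ rest → Z x ≡ true
            inside x∈ with unique lc
            ... | (_ ∷ a∉) ∷ b∉ ∷ _ = Z⁺ (K∌Y _ (sound lc (there (there x∈))))
                                        (All.lookup a∉ x∈ ∘ sym) (All.lookup b∉ x∈ ∘ sym)
            on-cycle : ∀ {x} → K x ≡ true → x ≢ a → x ≢ b → PathIn G Z c x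
            on-cycle Kx x≢a x≢b with complete lc Kx
            ... | here eq           = contradiction eq x≢a
            ... | there (here eq)   = contradiction eq x≢b
            ... | there (there x∈) = walk-connects G rest (proj₂ (proj₂ (lc-walk G lc))) (inside (here refl))
                                       (All.tabulate λ m → inside (there m)) x∈
            path : ∀ x → Z x ≡ true → PathIn G Z c x
            path x m with ∪∁⁻ (Y ∪⁅ a ⁆) b (not-true m)
            ... | m′ , x≢b with ∪∁⁻ Y a m′
            ...   | Yx , x≢a with K x in Kx
            ...     | true  = on-cycle Kx x≢a x≢b
            ...     | false with only-w x Yx Kx
            ...       | refl = path-trans (on-cycle Kz z≢a z≢b)
                                 (step (path-target (on-cycle Kz z≢a z≢b)) (adj-sym {G = G} e) (here Zw))
            conn : ConnectedOn G Z
            conn = connected-from c path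

      private
        y′ : Fin n
        y′ = y largest K∌Y

      -- All neighbours of `w` lie on the cycle, and 3-connectedness leaves one besides `a` and `b`.
      detached : ∀ {vs} → LongestCycleOn G K vs → ¬ Attached G Y w → ⊥
      detached lc₀ ¬attw
        with some-attachment G 3-connected closed (Yy largest K∌Y) (Ky largest K∌Y) K∌Y lc₀
        where
        closed : Closed {G = G} (∁ K) Y
        closed p q Yp Kq e with Y q in Yq
        ... | true  = refl
        ... | false with only-w q Yq (not-true Kq)
        ...   | refl = ⊥-elim (¬attw (p , Yp , adj-sym {G = G} e))
      ... | a , Ka , atta with rotate-to G lc₀ Ka
      ...   | []       , lc with s≤s () ← length≥3 lc
      ...   | b ∷ rest , lc
        with neighbour-avoiding G 3-connected {w} {a} {b} {y′} (outside≢ G 3-connected Kw Ka)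
               (outside≢ G 3-connected Kw (sound lc (there (here refl))))
               (λ { refl → true≢false (Yy largest K∌Y) Yw })
               (outside≢ G 3-connected (Ky largest K∌Y) Ka)
               (outside≢ G 3-connected (Ky largest K∌Y) (sound lc (there (here refl))))
      ...     | z , e , z≢a , z≢b =
        anchored lc e Kz z≢a z≢b atta (no-consecutive G (Y-connected largest K∌Y) (Y∌K largest K∌Y) lc atta)
        where
        Kz : K z ≡ true
        Kz with K z in eq
        ... | true  = refl
        ... | false with Y z in Yz
        ...   | true  = ⊥-elim (¬attw (z , Yz , e))
        ...   | false = ⊥-elim (adj⇒≢ {G = G} e (sym (only-w z Yz eq)))

      -- If moving `w` loses nothing, `Y ∪⁅ w ⁆` is again a largest bond and its far side is just
      -- the cycle. If it loses, `w` has a single neighbour `c` outside `Y`, and `a` and `b` must be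
      -- chosen different from `c`.
      attached : ∀ {vs} → LongestCycleOn G K vs → Attached G Y w → ⊥
      attached {[]} lc₀ _ with () ← length≥3 lc₀
      attached {v ∷ vs} lc₀ attw with bondSize G Y ≤? bondSize G (Y ∪⁅ w ⁆)
      ... | yes le = spanning-cycle {Y = Y ∪⁅ w ⁆} largest′ K∌Y′ lc₀ spans
                       (≤-trans (≤-reflexive (size-∪ Y w Yw)) (s≤s small))
        where
        K∌Y′ : ∀ x → K x ≡ true → (Y ∪⁅ w ⁆) x ≡ false
        K∌Y′ x Kx = ∪∁⁺ Y w (K∌Y x Kx) λ { refl → true≢false Kx Kw }
        spans : ∀ x → (Y ∪⁅ w ⁆) x ≡ false → K x ≡ true
        spans x m with ∪∁⁻ Y w m
        ... | Yx , x≢w with K x in Kx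
        ...   | true  = refl
        ...   | false = contradiction (only-w x Yx Kx) x≢w
        largest′ : IsLargestBond G (Y ∪⁅ w ⁆)
        largest′ = ((y′ , ∪⁺ˡ {U = Y} w (Yy largest K∌Y)) , (v , K∌Y′ v (sound lc₀ (here refl)))
                   , connected-∪ (Y-connected largest K∌Y) attw
                   , list-connected largest K∌Y (lc-walk G lc₀)
                       (All.tabulate λ m → not-false (K∌Y′ _ (sound lc₀ m)))
                       (λ x m → complete lc₀ (spans x (not-true m))))
                 , λ X′ side → ≤-trans (proj₂ largest X′ side) le
      ... | no nle with path-neighbour (outside≢ G 3-connected Kw (sound lc₀ (here refl)))
                          (∁Y-connected largest K∌Y w v (not-false Yw) (not-false (K∌Y v (sound lc₀ (here refl)))))
      ...   | c , Yc , e with rotate-to G lc₀ Kc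
        where
        Kc : K c ≡ true
        Kc with K c in eq
        ... | true  = refl
        ... | false = ⊥-elim (adj⇒≢ {G = G} e (sym (only-w c (not-true Yc) eq)))
      ...     | [] , lcᶜ with s≤s () ← length≥3 lcᶜ
      attached {v ∷ vs} lc₀ attw | no nle | c , Yc , e | u ∷ us , lcᶜ with unique lcᶜ
      ...     | (c≢u ∷ _) ∷ _
        with attachment-avoiding G 3-connected {D = Y ∪⁅ w ⁆} closed (∪⁺ˡ {U = Y} w (Yy largest K∌Y)) (Ky largest K∌Y)
               (sound lcᶜ (here refl)) (sound lcᶜ (here refl)) (sound lcᶜ (there (here refl)))
               (K∌D u (sound lcᶜ (there (here refl)))) (c≢u ∘ sym) (c≢u ∘ sym)
        where
        K∌D : ∀ x → K x ≡ true → (Y ∪⁅ w ⁆) x ≡ false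
        K∌D x Kx = ∪∁⁺ Y w (K∌Y x Kx) λ { refl → true≢false Kx Kw }
        closed : Closed {G = G} (∁ K) (Y ∪⁅ w ⁆)
        closed p q _ Kq _ with Y q in Yq
        ... | true  = refl
        ... | false with only-w q Yq (not-true Kq)
        ...   | refl = ≡ᵇ-refl w
      ...       | a , Ka , a≢c , _ , d , Dd , ead with rotate-to G lc₀ Ka
      ...         | [] , lc with s≤s () ← length≥3 lc
      attached {v ∷ vs} lc₀ attw | no nle | c , Yc , e | u ∷ us , lcᶜ | _ | a , Ka , a≢c , _ , d , Dd , ead | b ∷ rest , lc =
        anchored lc e (sound lcᶜ (here refl)) (a≢c ∘ sym) c≢b atta
          (λ attb → consecutive (attached-mono (λ x → ∪⁺ˡ {U = Y} w) attb))
        where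
        outdegree≤1 : degreeIn G (∁ Y) w ≤ 1
        outdegree≤1 = ≤-pred (≤-trans outdegree<indegree (≤-trans (degreeIn≤size Y w) small))
          where
          outdegree<indegree : degreeIn G (∁ Y) w < degreeIn G Y w
          outdegree<indegree = +-cancelˡ-< (bondSize G (Y ∪⁅ w ⁆)) _ _ (begin-strict
            bondSize G (Y ∪⁅ w ⁆) + degreeIn G (∁ Y) w  <⟨ +-monoˡ-< (degreeIn G (∁ Y) w) (≰⇒> nle) ⟩
            bondSize G Y + degreeIn G (∁ Y) w           ≡⟨ bondSize-∪ G Y w Yw ⟨
            bondSize G (Y ∪⁅ w ⁆) + degreeIn G Y w      ∎)
            where open ≤-Reasoning
        -- An attachment at `w` would make `a` a second neighbour of `w` outside `Y`, besides `c`.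
        atta : Attached G Y a
        atta with ∪⁻ Y w Dd
        ... | inj₁ Yd   = d , Yd , ead
        ... | inj₂ refl = ⊥-elim (<⇒≱ (two≤size (adj G w ∩ ∁ Y)
                (∧-intro (adj-sym {G = G} ead) (not-false (K∌Y a Ka))) (∧-intro e Yc) a≢c) outdegree≤1)
        consecutive : ¬ Attached G (Y ∪⁅ w ⁆) b
        consecutive = no-consecutive G (connected-∪ (Y-connected largest K∌Y) attw) D∌K lc (d , Dd , ead)
          where
          D∌K : ∀ x → (Y ∪⁅ w ⁆) x ≡ true → K x ≡ false
          D∌K x m with ∪⁻ Y w m
          ... | inj₁ Yx   = Y∌K largest K∌Y x Yx
          ... | inj₂ refl = Kw
        -- The successor of an attached vertex is not adjacent to `w`, but `c` is.
        c≢b : c ≢ b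
        c≢b refl = consecutive (w , ∪⁺ʳ Y w , adj-sym {G = G} e)

    -- The cases are none, at least two, or exactly one vertex outside both `K` and `Y`; two of them
    -- leave room for only one vertex in `Y`.
    long-cycle-meets : ∀ {Y vs} → LongestCycleOn G K vs → IsLargestBond G Y → (∀ x → K x ≡ true → Y x ≡ false) →
                       ¬ (size (∁ K) ≤ 3)
    long-cycle-meets {Y} lc largest K∌Y few
      with any? (λ w → (Y w ≟ᵇ false) ×-dec (K w ≟ᵇ false))
    ... | no none = spanning-cycle largest K∌Y lc spans
                      (≤-trans (size-mono λ x Yx → not-false (Y∌K largest K∌Y x Yx)) few)
      where
      spans : ∀ x → Y x ≡ false → K x ≡ true
      spans x Yx with K x in Kx
      ... | true  = refl
      ... | false = contradiction (x , Yx , Kx) none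
    ... | yes (w , Yw , Kw) with any? (λ x → (Y x ≟ᵇ false) ×-dec (K x ≟ᵇ false) ×-dec ¬? (x ≟ w))
    ...   | yes (x , Yx , Kx , x≢w) =
      singleton-side largest K∌Y lc few (≤-pred (≤-pred (begin
        suc (suc (size Y))                           ≤⟨ s≤s (s≤s (size-mono sub)) ⟩
        suc (suc (size (∁ K ∖⁅ w ⁆ ∖⁅ x ⁆)))         ≡⟨ cong suc (size-∖ (∁ K ∖⁅ w ⁆) x (∖⁺ (∁ K) w (not-false Kx) x≢w)) ⟨
        suc (size (∁ K ∖⁅ w ⁆))                      ≡⟨ size-∖ (∁ K) w (not-false Kw) ⟨
        size (∁ K)                                   ≤⟨ few ⟩
        3                                            ∎)))
      where
      open ≤-Reasoning
      sub : Y ⊆ (∁ K ∖⁅ w ⁆ ∖⁅ x ⁆)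
      sub z Yz = ∖⁺ (∁ K ∖⁅ w ⁆) x (∖⁺ (∁ K) w (not-false (Y∌K largest K∌Y z Yz))
                   (λ { refl → true≢false Yz Yw })) λ { refl → true≢false Yz Yx }
    ...   | no none = case attached? G Y w of λ where
        (yes att) → OneExtraVertex.attached largest K∌Y Yw Kw only-w small lc att
        (no ¬att) → OneExtraVertex.detached largest K∌Y Yw Kw only-w small lc ¬att
      where
      only-w : ∀ x → Y x ≡ false → K x ≡ false → x ≡ w
      only-w x Yx Kx with x ≟ w
      ... | yes eq = eq
      ... | no x≢w = contradiction (x , Yx , Kx , x≢w) none
      sub : Y ⊆ (∁ K ∖⁅ w ⁆)
      sub z Yz = ∖⁺ (∁ K) w (not-false (Y∌K largest K∌Y z Yz)) λ { refl → true≢false Yz Yw }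
      small : size Y ≤ 2
      small = ≤-pred (≤-trans (s≤s (size-mono sub)) (≤-trans (≤-reflexive (sym (size-∖ (∁ K) w (not-false Kw)))) few))

-- Choosing the side that avoids the cycle

largestBond-∁ : ∀ {n} (G : Graph n) X → IsLargestBond G X → IsLargestBond G (∁ X)
largestBond-∁ G X (((x , Xx) , (y , Xy) , c , c′) , max) =
  ((y , not-false Xy) , (x , cong not Xx) , c′ , connected-cong to from c)
  , λ X′ side → ≤-trans (max X′ side) (≤-reflexive (sym (bondSize-∁ G X)))
  where
  to : X ⊆ ∁ (∁ X)
  to x p rewrite p = refl
  from : ∁ (∁ X) ⊆ X
  from x p = not-injective (not-true p)

theorem1p4 : ∀ {n} (G : Graph n) → KConnected 3 G →
    ((∃[ C ] IsCycle G C × n ≤ length C + 3)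
    ⊎ (∃[ X ] IsBondSide G X × numEdges G ≤ bondSize G X + n + 1)) →
    ∀ C X → IsLongestCycle G C → IsLargestBond G X → Meets C X
theorem1p4 {n} G 3-connected hyp C X long large
  with Any.any? (λ p → ¬? (X (proj₁ p) ≟ᵇ X (proj₂ p))) (cycleEdges C)
... | yes meets = meets
... | no  none  = ⊥-elim (one-sided C long (All.map (decidable-stable (_ ≟ᵇ _)) (¬Any⇒All¬ _ none)))
  where
  module _ (C : List (Fin n)) (long : IsLongestCycle G C) where

    K : VSet n
    K x = does (_∈?_ _≟_ x C)

    cycle : LongestCycleOn G K C
    cycle = record
      { longest  = long
      ; sound    = λ {x} m → dec-true (_∈?_ _≟_ x C) m
      ; complete = λ {x} → member x
      }
      where
      member : ∀ x → K x ≡ true → x ∈ C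
      member x Kx with _∈?_ _≟_ x C
      ... | yes m = m

    few-outside : ∀ C′ → IsCycle G C′ → n ≤ length C′ + 3 → size (∁ K) ≤ 3
    few-outside C′ cyc bound = +-cancelˡ-≤ (size K) _ _ (begin
      size K + size (∁ K)  ≡⟨ size-∁ K ⟩
      n                    ≤⟨ bound ⟩
      length C′ + 3        ≤⟨ +-monoˡ-≤ 3 (proj₂ long C′ cyc) ⟩
      length C + 3         ≤⟨ +-monoˡ-≤ 3 (length≤size K (unique cycle) (All.tabulate (sound cycle))) ⟩
      size K + 3           ∎)
      where open ≤-Reasoning

    avoided : ∀ Y → IsLargestBond G Y → (∀ x → K x ≡ true → Y x ≡ false) → ⊥
    -- The hypothesis gives some cycle or some bond; passing to a longest or a largest one preserves
    -- its inequality.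
    avoided Y largest K∌Y = case hyp of λ where
      (inj₁ (C′ , cyc , bound)) →
        long-cycle-meets G 3-connected cycle largest K∌Y (few-outside C′ cyc bound)
      (inj₂ (X′ , side , bound)) → large-bond-meets G 3-connected cycle (proj₁ largest) K∌Y
        (≤-trans bound (+-monoˡ-≤ 1 (+-monoˡ-≤ n (proj₂ largest X′ side))))

  -- If no cycle edge is in the bond, `X` is constant along the cycle; its value decides whether
  -- `∁ X` or `X` takes the role of `Y`.
  one-sided : ∀ C → IsLongestCycle G C →
              All (λ p → X (proj₁ p) ≡ X (proj₂ p)) (cycleEdges C) → ⊥
  one-sided [] ((() , _) , _)
  one-sided (v ∷ vs) long same with walk-const {f = X} vs (all⇒walk vs same) | X v in Xv
  ... | const | true  = avoided (v ∷ vs) long (∁ X) (largestBond-∁ G X large) λ x Kx → cong not (value x Kx)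
    where
    value : ∀ x → K (v ∷ vs) long x ≡ true → X x ≡ true
    value x Kx with complete (cycle (v ∷ vs) long) Kx
    ... | here refl = Xv
    ... | there m   = trans (All.lookup const m) Xv
  ... | const | false = avoided (v ∷ vs) long X large value
    where
    value : ∀ x → K (v ∷ vs) long x ≡ true → X x ≡ false
    value x Kx with complete (cycle (v ∷ vs) long) Kx
    ... | here refl = Xv
    ... | there m   = trans (All.lookup const m) Xv
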